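{- Let $H,V:\mathsf{CPO}\to\mathsf{CPO}$ be endofunctors such that $H$, $V$ and $H+V$ are locally continuous and iteratable, and suppose that the functor $T(H+V)$ is locally continuous. Let $e:V\to T(H+V)$ be a guarded recursive program scheme and let $(A,a)$ be an $H$-algebra in $\mathsf{CPO}$ such that $A$ has a least element, considered as a complete Elgot algebra for $H$ by assigning to flat equation morphisms their least solutions. Then the function $R$ on $\mathsf{CPO}(VA,A)$ given by $$R(f)=\Bigl(VA\xrightarrow{\ e_A\ }T(H+V)A\xrightarrow{\ \widetilde{[a,f]}\ }A\Bigr)$$ is continuous, and its least fixed point is the standard interpreted solution $e^\ddagger_A:VA\to A$ of $e$ in $A$.
   Context: $\mathsf{CPO}$ is the category of $\omega$-complete partial orders (joins of all increasing $\omega$-chains exist; a least element is not required) and continuous maps (preserving joins of $\omega$-chains). Hom-sets $\mathsf{CPO}(X,Y)$ are cpos with the pointwise order. An endofunctor $F$ is locally continuous if each map $\mathsf{CPO}(X,Y)\to\mathsf{CPO}(FX,FY)$ is continuous. Coproduct injections are $\mathrm{inl},\mathrm{inr}$; identity morphisms are denoted by the name of the object. An endofunctor $H$ is iteratable if for every object $X$ the functor $H(\,\_\,)+X$ has a final coalgebra $\alpha^H_X:T(H)X\to H\,T(H)X+X$; it is an isomorphism with inverse $[\tau^H_X,\eta^H_X]$. $T(H)$ is a monad $(T(H),\eta^H,\mu^H)$: $T(H)f$ (for $f:X\to Y$) is the unique morphism with $T(H)f\cdot\tau^H_X=\tau^H_Y\cdot H\,T(H)f$ and $T(H)f\cdot\eta^H_X=\eta^H_Y\cdot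 f$; $\mu^H_X$ is the unique morphism with $\mu^H_X\cdot\tau^H_{T(H)X}=\tau^H_X\cdot H\mu^H_X$, $\mu^H_X\cdot\eta^H_{T(H)X}=\mathrm{id}$. Put $\kappa^H=\tau^H\cdot H\eta^H$. A recursive program scheme is a natural transformation $e:V\to T(H+V)$; it is guarded if $e=\tau^{H+V}\cdot(\mathrm{inl}\,T(H+V))\cdot f$ for some (necessarily unique) natural transformation $f:V\to H\,T(H+V)$. A flat equation morphism in $A$ (for $H$) is a morphism $d:X\to HX+A$; a solution in an $H$-algebra $(A,a)$ is $s:X\to A$ with $s=[a,A]\cdot(Hs+A)\cdot d$. If $H$ is locally continuous on $\mathsf{CPO}$ and $A$ has a least element, each $d$ has a least solution $d^*$ in $\mathsf{CPO}(X,A)$, and assigning $d\mapsto d^*$ makes $(A,a)$ a complete Elgot algebra (a known fact). Its evaluation morphism is $\widetilde a=(\alpha^H_A)^*:T(H)A\to A$, the least solution of $\alpha^H_A$. Likewise for $f\in\mathsf{CPO}(VA,A)$, $[a,f]:(H+V)A\to A$ is an $(H+V)$-algebra and $\widetilde{[a,f]}:T(H+V)A\to A$ is the least solution of the flat equation morphism $\alpha^{H+V}_A:T(H+V)A\to(H+V)T(H+V)A+A$. Standard interpreted solution. Write $S=T(H+V)$. The functor $HS+\mathrm{Id}$ is a monad with unit $\mathrm{inr}$ and multiplication $(HS+\mathrm{Id})(HS+\mathrm{Id})=HS(HS+\mathrm{Id})+HS+\mathrm{Id}\to HS+\mathrm{Id}$ given by $H\mu^{H+V}\cdot HS[\mu^{H+V}\cdot(\kappa^{H+V}\cdot\mathrm{inl})S,\eta^{H+V}]$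 on the first summand (followed by $\mathrm{inl}$) and by the identity on the remaining summands $HS+\mathrm{Id}$. For guarded $e$, with $f:V\to H\,T(H+V)$ the natural transformation satisfying $e=\tau^{H+V}\cdot(\mathrm{inl}\,T(H+V))\cdot f$, there is a unique monad morphism $\overline e:T(H+V)\to H\,T(H+V)+\mathrm{Id}$ with $\overline e\cdot\kappa^{H+V}=\mathrm{inl}\cdot[H\eta^{H+V},f]$. Its component $g=\overline e_A:T(H+V)A\to H\,T(H+V)A+A$ is a flat equation morphism in $A$, and the standard interpreted solution is $e^\ddagger_A=g^*\cdot\kappa^{H+V}_A\cdot\mathrm{inr}:VA\to A$. -}

module Defs where

open import Level using (Level) renaming (suc to lsuc)
open import Data.Nat.Base using (ℕ; zero; suc)
open import Data.Product.Base using (Σ; Σ-syntax; _×_; _,_; proj₁; proj₂)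
open import Data.Sum.Base as Sum using (_⊎_; inj₁; inj₂; fromInj₁; fromInj₂)
open import Data.Sum.Relation.Binary.Pointwise using (Pointwise; inj₁; inj₂; ⊎-poset)
open import Relation.Binary.Bundles using (Poset; Setoid)
open import Relation.Binary.Core using (_Preserves_⟶_)
open import Relation.Binary.Definitions using (Minimum)
import Relation.Binary.Reasoning.Setoid as SetoidReasoning

private
  variable
    ℓ : Level

module _ (P : Poset ℓ ℓ ℓ) where
  open Poset P

  record Chain : Set ℓ where
    field
      seq        : ℕ → Carrier
      increasing : ∀ n → seq n ≤ seq (suc n)

  open Chain

  record IsJoin (c : Chain) (x : Carrier) : Set ℓ where
    field
      upper : ∀ n → seq c n ≤ x
      least : ∀ y → (∀ n → seq c n ≤ y) → x ≤ y

open Chain public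

-- Without η-equality, coproducts and hom-cpos are compared by their
-- arguments instead of being unfolded.
record CPO (ℓ : Level) : Set (lsuc ℓ) where
  no-eta-equality
  field
    poset : Poset ℓ ℓ ℓ

  open Poset poset public

  field
    ⋁        : Chain poset → Carrier
    ⋁-isJoin : ∀ c → IsJoin poset c (⋁ c)

  setoid : Setoid ℓ ℓ
  setoid = record { isEquivalence = isEquivalence }

  ⋁-upper : ∀ c n → seq c n ≤ ⋁ c
  ⋁-upper c = IsJoin.upper (⋁-isJoin c)

  ⋁-least : ∀ c y → (∀ n → seq c n ≤ y) → ⋁ c ≤ y
  ⋁-least c = IsJoin.least (⋁-isJoin c)

open CPO using (Carrier)

mapChain : (X Y : CPO ℓ) (f : Carrier X → Carrier Y) →
           f Preserves CPO._≤_ X ⟶ CPO._≤_ Y →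
           Chain (CPO.poset X) → Chain (CPO.poset Y)
mapChain X Y f mono c = record
  { seq        = λ n → f (seq c n)
  ; increasing = λ n → mono (increasing c n)
  }

-- Monotonicity is implied by preservation of joins, but it has to come
-- first for the image of a chain to be a chain.
record IsContinuous (X Y : CPO ℓ) (f : Carrier X → Carrier Y) : Set ℓ where
  private
    module X = CPO X
    module Y = CPO Y
  field
    mono        : f Preserves X._≤_ ⟶ Y._≤_
    preserves-⋁ : ∀ c → f (X.⋁ c) Y.≈ Y.⋁ (mapChain X Y f mono c)

  cong : f Preserves X._≈_ ⟶ Y._≈_
  cong x≈y = Y.antisym (mono (X.reflexive x≈y)) (mono (X.reflexive (X.Eq.sym x≈y)))

infix 4 _⇒_
record _⇒_ (X Y : CPO ℓ) : Set ℓ where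
  no-eta-equality
  field
    to           : Carrier X → Carrier Y
    isContinuous : IsContinuous X Y to

  open IsContinuous isContinuous public

open _⇒_ public

infixr 8 _⟨$⟩_
_⟨$⟩_ : {X Y : CPO ℓ} → (X ⇒ Y) → Carrier X → Carrier Y
f ⟨$⟩ x = to f x

mkContinuous : (X Y : CPO ℓ) (f : Carrier X → Carrier Y)
               (f-mono : f Preserves CPO._≤_ X ⟶ CPO._≤_ Y) →
               (∀ c → CPO._≤_ Y (f (CPO.⋁ X c)) (CPO.⋁ Y (mapChain X Y f f-mono c))) →
               IsContinuous X Y f
mkContinuous X Y f f-mono f-⋁ = record
  { mono        = f-mono
  ; preserves-⋁ = λ c → Y.antisym (f-⋁ c)
      (Y.⋁-least _ _ λ n → f-mono (X.⋁-upper c n))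
  }
  where
  module X = CPO X
  module Y = CPO Y

id : {X : CPO ℓ} → X ⇒ X
id .to x = x
id {X = X} .isContinuous = mkContinuous X X (λ x → x) (λ p → p)
  λ c → X.⋁-least _ _ λ n → X.⋁-upper _ n
  where module X = CPO X

infixr 9 _∘_
_∘_ : {X Y Z : CPO ℓ} → (Y ⇒ Z) → (X ⇒ Y) → (X ⇒ Z)
(g ∘ f) .to x = g ⟨$⟩ f ⟨$⟩ x
_∘_ {X = X} {Y} {Z} g f .isContinuous =
  mkContinuous X Z _ (λ p → mono g (mono f p)) λ c →
    Z.trans (mono g (Y.reflexive (preserves-⋁ f c)))
    (Z.trans (Z.reflexive (preserves-⋁ g _))
    (Z.⋁-least _ _ λ n → Z.⋁-upper _ n))
  where
  module Y = CPO Y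
  module Z = CPO Z

module _ (X Y : CPO ℓ) where
  private
    module X = CPO X
    module Y = CPO Y

  homPoset : Poset ℓ ℓ ℓ
  homPoset = record
    { Carrier        = X ⇒ Y
    ; _≈_            = λ f g → ∀ x → f ⟨$⟩ x Y.≈ g ⟨$⟩ x
    ; _≤_            = λ f g → ∀ x → f ⟨$⟩ x Y.≤ g ⟨$⟩ x
    ; isPartialOrder = record
      { isPreorder = record
        { isEquivalence = record
          { refl  = λ x → Y.Eq.refl
          ; sym   = λ p x → Y.Eq.sym (p x)
          ; trans = λ p q x → Y.Eq.trans (p x) (q x)
          }
        ; reflexive = λ p x → Y.reflexive (p x)
        ; trans     = λ p q x → Y.trans (p x) (q x)
        }
      ; antisym = λ p q x → Y.antisym (p x) (q x)
      }
    }

  chainAt : Chain homPoset → X.Carrier → Chain Y.poset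
  chainAt c x = record
    { seq        = λ n → seq c n ⟨$⟩ x
    ; increasing = λ n → increasing c n x
    }

  pointwise-⋁ : Chain homPoset → X ⇒ Y
  pointwise-⋁ c .to x = Y.⋁ (chainAt c x)
  pointwise-⋁ c .isContinuous = mkContinuous X Y _
    (λ {x} {y} p → Y.⋁-least _ _ λ n →
      Y.trans (mono (seq c n) p) (Y.⋁-upper (chainAt c y) n))
    λ d → Y.⋁-least _ _ λ n →
      Y.trans (Y.reflexive (preserves-⋁ (seq c n) d))
        (Y.⋁-least _ _ λ m →
          Y.trans (Y.⋁-upper (chainAt c (seq d m)) n) (Y.⋁-upper _ m))

[_⇨_] : CPO ℓ → CPO ℓ → CPO ℓ
[ X ⇨ Y ] .CPO.poset      = homPoset X Y
[ X ⇨ Y ] .CPO.⋁          = pointwise-⋁ X Y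
[ X ⇨ Y ] .CPO.⋁-isJoin c = record
  { upper = λ n x → CPO.⋁-upper Y (chainAt X Y c x) n
  ; least = λ g h x → CPO.⋁-least Y (chainAt X Y c x) (g ⟨$⟩ x) (λ n → h n x)
  }

infix 4 _≈_
_≈_ : {X Y : CPO ℓ} → (X ⇒ Y) → (X ⇒ Y) → Set ℓ
_≈_ {X = X} {Y} = CPO._≈_ [ X ⇨ Y ]

module _ (X Y : CPO ℓ) where
  private
    module X = CPO X
    module Y = CPO Y
    P : Poset ℓ ℓ ℓ
    P = ⊎-poset X.poset Y.poset
    module P = Poset P

  left : X.Carrier → Chain P → Chain X.poset
  left x c = record
    { seq        = λ n → fromInj₁ (λ _ → x) (seq c n)
    ; increasing = λ n → lemma (increasing c n)
    }
    where
    lemma : ∀ {u v} → u P.≤ v → fromInj₁ (λ _ → x) u X.≤ fromInj₁ (λ _ → x) v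
    lemma (inj₁ p) = p
    lemma (inj₂ _) = X.refl

  right : Y.Carrier → Chain P → Chain Y.poset
  right y c = record
    { seq        = λ n → fromInj₂ (λ _ → y) (seq c n)
    ; increasing = λ n → lemma (increasing c n)
    }
    where
    lemma : ∀ {u v} → u P.≤ v → fromInj₂ (λ _ → y) u Y.≤ fromInj₂ (λ _ → y) v
    lemma (inj₁ _) = Y.refl
    lemma (inj₂ p) = p

  -- All members of a chain lie in the same summand as the first one.
  ⊎-⋁ : P.Carrier → Chain P → P.Carrier
  ⊎-⋁ (inj₁ x) c = inj₁ (X.⋁ (left x c))
  ⊎-⋁ (inj₂ y) c = inj₂ (Y.⋁ (right y c))

  ⊎-above : ∀ (c : Chain P) n → seq c 0 P.≤ seq c n
  ⊎-above c zero    = P.refl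
  ⊎-above c (suc n) = P.trans (⊎-above c n) (increasing c n)

  ⊎-⋁-isJoin : ∀ u (c : Chain P) → (∀ n → u P.≤ seq c n) → IsJoin P c (⊎-⋁ u c)
  ⊎-⋁-isJoin (inj₁ x) c h = record { upper = up ; least = low }
    where
    up : ∀ n → seq c n P.≤ inj₁ (X.⋁ (left x c))
    up n with seq c n | h n | X.⋁-upper (left x c) n
    ... | inj₁ _ | inj₁ _ | p = inj₁ p

    low : ∀ z → (∀ n → seq c n P.≤ z) → inj₁ (X.⋁ (left x c)) P.≤ z
    low z k with P.trans (h 0) (k 0)
    low (inj₁ z) k | inj₁ _ = inj₁ (X.⋁-least _ z bound)
      where
      bound : ∀ n → fromInj₁ (λ _ → x) (seq c n) X.≤ z
      bound n with seq c n | k n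
      ... | inj₁ _ | inj₁ p = p
  ⊎-⋁-isJoin (inj₂ y) c h = record { upper = up ; least = low }
    where
    up : ∀ n → seq c n P.≤ inj₂ (Y.⋁ (right y c))
    up n with seq c n | h n | Y.⋁-upper (right y c) n
    ... | inj₂ _ | inj₂ _ | p = inj₂ p

    low : ∀ z → (∀ n → seq c n P.≤ z) → inj₂ (Y.⋁ (right y c)) P.≤ z
    low z k with P.trans (h 0) (k 0)
    low (inj₂ z) k | inj₂ _ = inj₂ (Y.⋁-least _ z bound)
      where
      bound : ∀ n → fromInj₂ (λ _ → y) (seq c n) Y.≤ z
      bound n with seq c n | k n
      ... | inj₂ _ | inj₂ p = p

infixr 6 _⊕_
_⊕_ : CPO ℓ → CPO ℓ → CPO ℓ
(X ⊕ Y) .CPO.poset      = ⊎-poset (CPO.poset X) (CPO.poset Y)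
(X ⊕ Y) .CPO.⋁ c        = ⊎-⋁ X Y (seq c 0) c
(X ⊕ Y) .CPO.⋁-isJoin c = ⊎-⋁-isJoin X Y (seq c 0) c (⊎-above X Y c)

inl : {X Y : CPO ℓ} → X ⇒ X ⊕ Y
inl .to = inj₁
inl {X = X} {Y} .isContinuous = mkContinuous X (X ⊕ Y) inj₁ inj₁ λ c →
  inj₁ (X.⋁-least _ _ λ n → X.⋁-upper _ n)
  where module X = CPO X

inr : {X Y : CPO ℓ} → Y ⇒ X ⊕ Y
inr .to = inj₂
inr {X = X} {Y} .isContinuous = mkContinuous Y (X ⊕ Y) inj₂ inj₂ λ c →
  inj₂ (Y.⋁-least _ _ λ n → Y.⋁-upper _ n)
  where module Y = CPO Y

[_,_] : {X Y Z : CPO ℓ} → (X ⇒ Z) → (Y ⇒ Z) → (X ⊕ Y ⇒ Z)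
[ f , g ] .to = Sum.[ to f , to g ]
[_,_] {X = X} {Y} {Z} f g .isContinuous = mkContinuous (X ⊕ Y) Z h h-mono h-⋁
  where
  module Z = CPO Z
  module XY = CPO (X ⊕ Y)

  h : XY.Carrier → Z.Carrier
  h = Sum.[ to f , to g ]

  h-mono : h Preserves XY._≤_ ⟶ Z._≤_
  h-mono (inj₁ p) = mono f p
  h-mono (inj₂ p) = mono g p

  h-⋁ : ∀ c → h (XY.⋁ c) Z.≤ Z.⋁ (mapChain (X ⊕ Y) Z h h-mono c)
  h-⋁ c with seq c 0 | ⊎-above X Y c
  ... | inj₁ x | p = Z.trans (Z.reflexive (preserves-⋁ f _))
                      (Z.⋁-least _ _ λ n → Z.trans (member n) (Z.⋁-upper _ n))
    where
    member : ∀ n → f ⟨$⟩ fromInj₁ (λ _ → x) (seq c n) Z.≤ h (seq c n)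
    member n with seq c n | p n
    ... | inj₁ _ | inj₁ _ = Z.refl
  ... | inj₂ y | p = Z.trans (Z.reflexive (preserves-⋁ g _))
                      (Z.⋁-least _ _ λ n → Z.trans (member n) (Z.⋁-upper _ n))
    where
    member : ∀ n → g ⟨$⟩ fromInj₂ (λ _ → y) (seq c n) Z.≤ h (seq c n)
    member n with seq c n | p n
    ... | inj₂ _ | inj₂ _ = Z.refl

infixr 6 _⊕₁_
_⊕₁_ : {X X′ Y Y′ : CPO ℓ} → (X ⇒ X′) → (Y ⇒ Y′) → (X ⊕ Y ⇒ X′ ⊕ Y′)
f ⊕₁ g = [ inl ∘ f , inr ∘ g ]

record Functor (ℓ : Level) : Set (lsuc ℓ) where
  no-eta-equality
  field
    F₀           : CPO ℓ → CPO ℓ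
    F₁           : ∀ {X Y} → (X ⇒ Y) → (F₀ X ⇒ F₀ Y)
    F-resp-≈     : ∀ {X Y} {f g : X ⇒ Y} → f ≈ g → F₁ f ≈ F₁ g
    identity     : ∀ {X} → F₁ (id {X = X}) ≈ id
    homomorphism : ∀ {X Y Z} {f : X ⇒ Y} {g : Y ⇒ Z} → F₁ (g ∘ f) ≈ F₁ g ∘ F₁ f

open Functor public

LocallyContinuous : Functor ℓ → Set (lsuc ℓ)
LocallyContinuous F =
  ∀ X Y → IsContinuous [ X ⇨ Y ] [ F₀ F X ⇨ F₀ F Y ] (F₁ F)

Id : Functor ℓ
Id .F₀ X           = X
Id .F₁ f           = f
Id .F-resp-≈ p     = p
Id .identity {X} _ = CPO.Eq.refl X
Id .homomorphism {Z = Z} _ = CPO.Eq.refl Z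

Const : CPO ℓ → Functor ℓ
Const A .F₀ _          = A
Const A .F₁ _          = id
Const A .F-resp-≈ _ _  = CPO.Eq.refl A
Const A .identity _    = CPO.Eq.refl A
Const A .homomorphism _ = CPO.Eq.refl A

infixr 9 _∘F_
_∘F_ : Functor ℓ → Functor ℓ → Functor ℓ
(G ∘F F) .F₀ X       = F₀ G (F₀ F X)
(G ∘F F) .F₁ f       = F₁ G (F₁ F f)
(G ∘F F) .F-resp-≈ p = F-resp-≈ G (F-resp-≈ F p)
(G ∘F F) .identity {X} x = CPO.Eq.trans (F₀ G (F₀ F X))
  (F-resp-≈ G (identity F) x) (identity G x)
(G ∘F F) .homomorphism {Z = Z} x = CPO.Eq.trans (F₀ G (F₀ F Z))
  (F-resp-≈ G (homomorphism F) x) (homomorphism G x)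

infixr 6 _+F_
_+F_ : Functor ℓ → Functor ℓ → Functor ℓ
(F +F G) .F₀ X = F₀ F X ⊕ F₀ G X
(F +F G) .F₁ f = F₁ F f ⊕₁ F₁ G f
(F +F G) .F-resp-≈ p (inj₁ x)   = inj₁ (F-resp-≈ F p x)
(F +F G) .F-resp-≈ p (inj₂ x)   = inj₂ (F-resp-≈ G p x)
(F +F G) .identity (inj₁ x)     = inj₁ (identity F x)
(F +F G) .identity (inj₂ x)     = inj₂ (identity G x)
(F +F G) .homomorphism (inj₁ x) = inj₁ (homomorphism F x)
(F +F G) .homomorphism (inj₂ x) = inj₂ (homomorphism G x)

infix 4 _⟹_
record _⟹_ (F G : Functor ℓ) : Set (lsuc ℓ) where
  no-eta-equality
  field
    at      : ∀ X → F₀ F X ⇒ F₀ G X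
    natural : ∀ {X Y} (f : X ⇒ Y) → at Y ∘ F₁ F f ≈ F₁ G f ∘ at X

open _⟹_ public

record Monad (ℓ : Level) : Set (lsuc ℓ) where
  field
    functor   : Functor ℓ
    unit      : Id ⟹ functor
    mult      : functor ∘F functor ⟹ functor
    assoc     : ∀ X → at mult X ∘ F₁ functor (at mult X)
                      ≈ at mult X ∘ at mult (F₀ functor X)
    identityˡ : ∀ X → at mult X ∘ F₁ functor (at unit X) ≈ id
    identityʳ : ∀ X → at mult X ∘ at unit (F₀ functor X) ≈ id

record MonadMorphism (M N : Monad ℓ) : Set (lsuc ℓ) where
  private
    module M = Monad M
    module N = Monad N
  field
    transformation : M.functor ⟹ N.functor
    preserves-unit : ∀ X → at transformation X ∘ at M.unit X ≈ at N.unit X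
    preserves-mult : ∀ X →
      at transformation X ∘ at M.mult X
      ≈ at N.mult X ∘ F₁ N.functor (at transformation X)
                    ∘ at transformation (F₀ M.functor X)

  open _⟹_ transformation public

record FinalCoalgebra (F : Functor ℓ) : Set (lsuc ℓ) where
  no-eta-equality
  field
    carrier         : CPO ℓ
    structure       : carrier ⇒ F₀ F carrier
    unfold          : ∀ {Z} → (Z ⇒ F₀ F Z) → (Z ⇒ carrier)
    unfold-commutes : ∀ {Z} (c : Z ⇒ F₀ F Z) →
                      structure ∘ unfold c ≈ F₁ F (unfold c) ∘ c
    unfold-unique   : ∀ {Z} (c : Z ⇒ F₀ F Z) (h : Z ⇒ carrier) →
                      structure ∘ h ≈ F₁ F h ∘ c → h ≈ unfold c

module Lambek {F : Functor ℓ} (C : FinalCoalgebra F) where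
  open FinalCoalgebra C

  private
    module C = CPO carrier
    module FC = CPO (F₀ F carrier)

  unfold-unique₂ : ∀ {Z} (c : Z ⇒ F₀ F Z) (p q : Z ⇒ carrier) →
                   structure ∘ p ≈ F₁ F p ∘ c → structure ∘ q ≈ F₁ F q ∘ c → p ≈ q
  unfold-unique₂ c p q hp hq z =
    C.Eq.trans (unfold-unique c p hp z) (C.Eq.sym (unfold-unique c q hq z))

  inverse : F₀ F carrier ⇒ carrier
  inverse = unfold (F₁ F structure)

  inverseˡ : inverse ∘ structure ≈ id
  inverseˡ = unfold-unique₂ structure (inverse ∘ structure) id
    (λ z → FC.Eq.trans (unfold-commutes (F₁ F structure) (structure ⟨$⟩ z))
             (FC.Eq.sym (homomorphism F {f = structure} {g = inverse} (structure ⟨$⟩ z))))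
    (λ z → FC.Eq.sym (identity F (structure ⟨$⟩ z)))

  inverseʳ : structure ∘ inverse ≈ id
  inverseʳ z = begin
    structure ⟨$⟩ inverse ⟨$⟩ z             ≈⟨ unfold-commutes (F₁ F structure) z ⟩
    F₁ F inverse ⟨$⟩ F₁ F structure ⟨$⟩ z   ≈⟨ homomorphism F {f = structure} {g = inverse} z ⟨
    F₁ F (inverse ∘ structure) ⟨$⟩ z        ≈⟨ F-resp-≈ F {f = inverse ∘ structure} {g = id} inverseˡ z ⟩
    F₁ F (id {X = carrier}) ⟨$⟩ z           ≈⟨ identity F z ⟩
    z                                       ∎
    where open SetoidReasoning FC.setoid

Iteratable : Functor ℓ → Set (lsuc ℓ)
Iteratable H = ∀ X → FinalCoalgebra (H +F Const X)

module CompletelyIterativeMonad {ℓ : Level} (H : Functor ℓ) (it : Iteratable H) where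

  T₀ : CPO ℓ → CPO ℓ
  T₀ X = FinalCoalgebra.carrier (it X)

  α : ∀ X → T₀ X ⇒ F₀ H (T₀ X) ⊕ X
  α X = FinalCoalgebra.structure (it X)

  α⁻¹ : ∀ X → F₀ H (T₀ X) ⊕ X ⇒ T₀ X
  α⁻¹ X = Lambek.inverse (it X)

  τ : ∀ X → F₀ H (T₀ X) ⇒ T₀ X
  τ X = α⁻¹ X ∘ inl

  η : ∀ X → X ⇒ T₀ X
  η X = α⁻¹ X ∘ inr

  κ : ∀ X → F₀ H X ⇒ T₀ X
  κ X = τ X ∘ F₁ H (η X)

  α⁻¹∘α : ∀ X → α⁻¹ X ∘ α X ≈ id
  α⁻¹∘α X = Lambek.inverseˡ (it X)

  α∘α⁻¹ : ∀ X → α X ∘ α⁻¹ X ≈ id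
  α∘α⁻¹ X = Lambek.inverseʳ (it X)

  α-τ : ∀ X → α X ∘ τ X ≈ inl
  α-τ X h = α∘α⁻¹ X (inj₁ h)

  α-η : ∀ X → α X ∘ η X ≈ inr
  α-η X x = α∘α⁻¹ X (inj₂ x)

  private
    module T X = CPO (T₀ X)

  α⁻¹-cases : ∀ {X Z} (p q : T₀ X ⇒ Z) → p ∘ τ X ≈ q ∘ τ X → p ∘ η X ≈ q ∘ η X → p ≈ q
  α⁻¹-cases {X} {Z} p q pτ pη t = begin
    p ⟨$⟩ t                    ≈⟨ cong p (α⁻¹∘α X t) ⟨
    p ⟨$⟩ α⁻¹ X ⟨$⟩ α X ⟨$⟩ t  ≈⟨ on (α X ⟨$⟩ t) ⟩
    q ⟨$⟩ α⁻¹ X ⟨$⟩ α X ⟨$⟩ t  ≈⟨ cong q (α⁻¹∘α X t) ⟩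
    q ⟨$⟩ t                    ∎
    where
    open SetoidReasoning (CPO.setoid Z)

    on : p ∘ α⁻¹ X ≈ q ∘ α⁻¹ X
    on (inj₁ h) = pτ h
    on (inj₂ x) = pη x

  module Solve {Y Z : CPO ℓ} (d : Z ⇒ F₀ H Z ⊕ T₀ Y) where
    private
      HY : Functor ℓ
      HY = H +F Const Y

      module C = FinalCoalgebra (it Y)
      module TY = CPO (T₀ Y)
      module HTY = CPO (F₀ HY (T₀ Y))

      w : Z ⊕ T₀ Y ⇒ F₀ H (Z ⊕ T₀ Y) ⊕ Y
      w = [ [ inl ∘ F₁ H inl , F₁ HY inr ∘ α Y ] ∘ d , F₁ HY inr ∘ α Y ]

      u : Z ⊕ T₀ Y ⇒ T₀ Y
      u = C.unfold w

      u-inr : u ∘ inr ≈ id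
      u-inr = Lambek.unfold-unique₂ (it Y) (α Y) (u ∘ inr) id
        (λ t → HTY.Eq.trans (C.unfold-commutes w (inj₂ t))
                 (HTY.Eq.sym (homomorphism HY {f = inr} {g = u} (α Y ⟨$⟩ t))))
        (λ t → HTY.Eq.sym (identity HY (α Y ⟨$⟩ t)))

    solve : Z ⇒ T₀ Y
    solve = u ∘ inl

    solves : solve ≈ [ τ Y , id ] ∘ (F₁ H solve ⊕₁ id) ∘ d
    solves z = TY.Eq.trans
      (TY.Eq.sym (α⁻¹∘α Y (u ⟨$⟩ inj₁ z)))
      (TY.Eq.trans (cong (α⁻¹ Y) (C.unfold-commutes w (inj₁ z))) (body (d ⟨$⟩ z)))
      where
      body : α⁻¹ Y ∘ F₁ HY u ∘ [ inl ∘ F₁ H inl , F₁ HY inr ∘ α Y ]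
             ≈ [ τ Y , id ] ∘ (F₁ H solve ⊕₁ id)
      body (inj₁ h) = cong (τ Y) (CPO.Eq.sym (F₀ H (T₀ Y)) (homomorphism H {f = inl} {g = u} h))
      body (inj₂ t) = begin
        α⁻¹ Y ⟨$⟩ F₁ HY u ⟨$⟩ F₁ HY inr ⟨$⟩ α Y ⟨$⟩ t
          ≈⟨ cong (α⁻¹ Y) (homomorphism HY {f = inr} {g = u} (α Y ⟨$⟩ t)) ⟨
        α⁻¹ Y ⟨$⟩ F₁ HY (u ∘ inr) ⟨$⟩ α Y ⟨$⟩ t
          ≈⟨ cong (α⁻¹ Y) (F-resp-≈ HY {f = u ∘ inr} {g = id} u-inr (α Y ⟨$⟩ t)) ⟩
        α⁻¹ Y ⟨$⟩ F₁ HY (id {X = T₀ Y}) ⟨$⟩ α Y ⟨$⟩ t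
          ≈⟨ cong (α⁻¹ Y) (identity HY (α Y ⟨$⟩ t)) ⟩
        α⁻¹ Y ⟨$⟩ α Y ⟨$⟩ t
          ≈⟨ α⁻¹∘α Y t ⟩
        t ∎
        where open SetoidReasoning TY.setoid

    unique : (s : Z ⇒ T₀ Y) → s ≈ [ τ Y , id ] ∘ (F₁ H s ⊕₁ id) ∘ d → s ≈ solve
    unique s s-solves z = C.unfold-unique w s,id commutes (inj₁ z)
      where
      open SetoidReasoning HTY.setoid

      s,id : Z ⊕ T₀ Y ⇒ T₀ Y
      s,id = [ s , id ]

      on-inr : α Y ≈ F₁ HY s,id ∘ F₁ HY inr ∘ α Y
      on-inr t = begin
        α Y ⟨$⟩ t                                        ≈⟨ identity HY (α Y ⟨$⟩ t) ⟨
        F₁ HY (id {X = T₀ Y}) ⟨$⟩ α Y ⟨$⟩ t              ≈⟨ F-resp-≈ HY {f = id} {g = s,id ∘ inr} (λ _ → TY.Eq.refl) (α Y ⟨$⟩ t) ⟩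
        F₁ HY (s,id ∘ inr) ⟨$⟩ α Y ⟨$⟩ t                 ≈⟨ homomorphism HY {f = inr} {g = s,id} (α Y ⟨$⟩ t) ⟩
        F₁ HY s,id ⟨$⟩ F₁ HY inr ⟨$⟩ α Y ⟨$⟩ t           ∎

      on-d : α Y ∘ [ τ Y , id ] ∘ (F₁ H s ⊕₁ id)
             ≈ F₁ HY s,id ∘ [ inl ∘ F₁ H inl , F₁ HY inr ∘ α Y ]
      on-d (inj₁ h) = begin
        α Y ⟨$⟩ τ Y ⟨$⟩ F₁ H s ⟨$⟩ h              ≈⟨ α-τ Y (F₁ H s ⟨$⟩ h) ⟩
        inj₁ (F₁ H s ⟨$⟩ h)                       ≈⟨ inj₁ (F-resp-≈ H {f = s} {g = s,id ∘ inl} (λ _ → TY.Eq.refl) h) ⟩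
        inj₁ (F₁ H (s,id ∘ inl) ⟨$⟩ h)            ≈⟨ inj₁ (homomorphism H {f = inl} {g = s,id} h) ⟩
        inj₁ (F₁ H s,id ⟨$⟩ F₁ H inl ⟨$⟩ h)       ∎
      on-d (inj₂ t) = on-inr t

      commutes : α Y ∘ s,id ≈ F₁ HY s,id ∘ w
      commutes (inj₁ z) = HTY.Eq.trans (cong (α Y) (s-solves z)) (on-d (d ⟨$⟩ z))
      commutes (inj₂ t) = on-inr t

  infixl 10 _♯
  _♯ : ∀ {X Y} → (X ⇒ T₀ Y) → (T₀ X ⇒ T₀ Y)
  _♯ {X} f = Solve.solve ((id ⊕₁ f) ∘ α X)

  private
    ♯-α : ∀ {X Y} (f : X ⇒ T₀ Y) v →
          T._≈_ Y (f ♯ ⟨$⟩ α⁻¹ X ⟨$⟩ v) ([ τ Y ∘ F₁ H (f ♯) , f ] ⟨$⟩ v)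
    ♯-α {X} {Y} f v = begin
      f ♯ ⟨$⟩ α⁻¹ X ⟨$⟩ v
        ≈⟨ Solve.solves ((id ⊕₁ f) ∘ α X) (α⁻¹ X ⟨$⟩ v) ⟩
      step ⟨$⟩ α X ⟨$⟩ α⁻¹ X ⟨$⟩ v
        ≈⟨ cong step (α∘α⁻¹ X v) ⟩
      step ⟨$⟩ v
        ≈⟨ on v ⟩
      [ τ Y ∘ F₁ H (f ♯) , f ] ⟨$⟩ v ∎
      where
      open SetoidReasoning (T.setoid Y)

      step : F₀ H (T₀ X) ⊕ X ⇒ T₀ Y
      step = [ τ Y , id ] ∘ (F₁ H (f ♯) ⊕₁ id) ∘ (id ⊕₁ f)

      on : step ≈ [ τ Y ∘ F₁ H (f ♯) , f ]
      on (inj₁ _) = T.Eq.refl Y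
      on (inj₂ _) = T.Eq.refl Y

  ♯-τ : ∀ {X Y} (f : X ⇒ T₀ Y) → f ♯ ∘ τ X ≈ τ Y ∘ F₁ H (f ♯)
  ♯-τ f h = ♯-α f (inj₁ h)

  ♯-η : ∀ {X Y} (f : X ⇒ T₀ Y) → f ♯ ∘ η X ≈ f
  ♯-η f x = ♯-α f (inj₂ x)

  ♯-unique : ∀ {X Y} (f : X ⇒ T₀ Y) (p : T₀ X ⇒ T₀ Y) →
             p ∘ τ X ≈ τ Y ∘ F₁ H p → p ∘ η X ≈ f → p ≈ f ♯
  ♯-unique {X} {Y} f p pτ pη = Solve.unique ((id ⊕₁ f) ∘ α X) p
    (α⁻¹-cases p ([ τ Y , id ] ∘ (F₁ H p ⊕₁ id) ∘ (id ⊕₁ f) ∘ α X)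
      (λ h → T.Eq.trans Y (pτ h) (T.Eq.sym Y (cong ([ τ Y , id ] ∘ (F₁ H p ⊕₁ id) ∘ (id ⊕₁ f)) (α-τ X h))))
      (λ x → T.Eq.trans Y (pη x) (T.Eq.sym Y (cong ([ τ Y , id ] ∘ (F₁ H p ⊕₁ id) ∘ (id ⊕₁ f)) (α-η X x)))))

  ♯-unique₂ : ∀ {X Y} (p q : T₀ X ⇒ T₀ Y) →
              p ∘ τ X ≈ τ Y ∘ F₁ H p → q ∘ τ X ≈ τ Y ∘ F₁ H q → p ∘ η X ≈ q ∘ η X → p ≈ q
  ♯-unique₂ {X} {Y} p q pτ qτ pη t = T.Eq.trans Y
    (♯-unique (q ∘ η X) p pτ pη t)
    (T.Eq.sym Y (♯-unique (q ∘ η X) q qτ (λ _ → T.Eq.refl Y) t))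

  id-τ : ∀ {X} → id ∘ τ X ≈ τ X ∘ F₁ H id
  id-τ {X} h = cong (τ X) (CPO.Eq.sym (F₀ H (T₀ X)) (identity H h))

  ∘-τ : ∀ {X Y Z} (q : T₀ Y ⇒ T₀ Z) (p : T₀ X ⇒ T₀ Y) →
        q ∘ τ Y ≈ τ Z ∘ F₁ H q → p ∘ τ X ≈ τ Y ∘ F₁ H p →
        (q ∘ p) ∘ τ X ≈ τ Z ∘ F₁ H (q ∘ p)
  ∘-τ {X} {Y} {Z} q p qτ pτ h = begin
    q ⟨$⟩ p ⟨$⟩ τ X ⟨$⟩ h               ≈⟨ cong q (pτ h) ⟩
    q ⟨$⟩ τ Y ⟨$⟩ F₁ H p ⟨$⟩ h          ≈⟨ qτ (F₁ H p ⟨$⟩ h) ⟩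
    τ Z ⟨$⟩ F₁ H q ⟨$⟩ F₁ H p ⟨$⟩ h     ≈⟨ cong (τ Z) (homomorphism H {f = p} {g = q} h) ⟨
    τ Z ⟨$⟩ F₁ H (q ∘ p) ⟨$⟩ h          ∎
    where open SetoidReasoning (T.setoid Z)

  -- By ♯-unique, T₁ f is the only morphism satisfying T₁-τ and T₁-η, and
  -- μ X the only one satisfying μ-τ and μ-η.
  T₁ : ∀ {X Y} → (X ⇒ Y) → (T₀ X ⇒ T₀ Y)
  T₁ {X} {Y} f = (η Y ∘ f) ♯

  T₁-τ : ∀ {X Y} (f : X ⇒ Y) → T₁ f ∘ τ X ≈ τ Y ∘ F₁ H (T₁ f)
  T₁-τ {Y = Y} f = ♯-τ (η Y ∘ f)

  T₁-η : ∀ {X Y} (f : X ⇒ Y) → T₁ f ∘ η X ≈ η Y ∘ f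
  T₁-η {Y = Y} f = ♯-η (η Y ∘ f)

  T : Functor ℓ
  T .F₀ = T₀
  T .F₁ = T₁
  T .F-resp-≈ {Y = Y} {f} {g} f≈g = ♯-unique₂ (T₁ f) (T₁ g) (T₁-τ f) (T₁-τ g)
    (λ x → T.Eq.trans Y (T₁-η f x)
      (T.Eq.trans Y (cong (η Y) (f≈g x)) (T.Eq.sym Y (T₁-η g x))))
  T .identity = ♯-unique₂ (T₁ id) id (T₁-τ id) id-τ (T₁-η id)
  T .homomorphism {Z = Z} {f} {g} = ♯-unique₂ (T₁ (g ∘ f)) (T₁ g ∘ T₁ f)
    (T₁-τ (g ∘ f)) (∘-τ (T₁ g) (T₁ f) (T₁-τ g) (T₁-τ f))
    (λ x → T.Eq.trans Z (T₁-η (g ∘ f) x) (T.Eq.sym Z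
      (T.Eq.trans Z (cong (T₁ g) (T₁-η f x)) (T₁-η g (f ⟨$⟩ x)))))

  ηN : Id ⟹ T
  ηN = record
    { at      = η
    ; natural = λ {X} {Y} f x → T.Eq.sym Y (T₁-η f x)
    }

  μ : ∀ X → T₀ (T₀ X) ⇒ T₀ X
  μ X = id ♯

  μ-τ : ∀ X → μ X ∘ τ (T₀ X) ≈ τ X ∘ F₁ H (μ X)
  μ-τ X = ♯-τ id

  μ-η : ∀ X → μ X ∘ η (T₀ X) ≈ id
  μ-η X = ♯-η id

  μN : T ∘F T ⟹ T
  μN = record
    { at      = μ
    ; natural = λ {X} {Y} f → ♯-unique₂ (μ Y ∘ T₁ (T₁ f)) (T₁ f ∘ μ X)
        (∘-τ (μ Y) (T₁ (T₁ f)) (μ-τ Y) (T₁-τ (T₁ f)))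
        (∘-τ (T₁ f) (μ X) (T₁-τ f) (μ-τ X))
        (λ t → T.Eq.trans Y (cong (μ Y) (T₁-η (T₁ f) t))
          (T.Eq.trans Y (μ-η Y (T₁ f ⟨$⟩ t)) (T.Eq.sym Y (cong (T₁ f) (μ-η X t)))))
    }

  monad : Monad ℓ
  monad = record
    { functor   = T
    ; unit      = ηN
    ; mult      = μN
    ; assoc     = λ X → ♯-unique₂ (μ X ∘ T₁ (μ X)) (μ X ∘ μ (T₀ X))
        (∘-τ (μ X) (T₁ (μ X)) (μ-τ X) (T₁-τ (μ X)))
        (∘-τ (μ X) (μ (T₀ X)) (μ-τ X) (μ-τ (T₀ X)))
        (λ t → T.Eq.trans X (cong (μ X) (T₁-η (μ X) t))
          (T.Eq.trans X (μ-η X (μ X ⟨$⟩ t)) (T.Eq.sym X (cong (μ X) (μ-η (T₀ X) t)))))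
    ; identityˡ = λ X → ♯-unique₂ (μ X ∘ T₁ (η X)) id
        (∘-τ (μ X) (T₁ (η X)) (μ-τ X) (T₁-τ (η X))) id-τ
        (λ x → T.Eq.trans X (cong (μ X) (T₁-η (η X) x)) (μ-η X (η X ⟨$⟩ x)))
    ; identityʳ = μ-η
    }

module _ (D : CPO ℓ) where
  private
    module D = CPO D

  record IsLeastFixedPoint (φ : D.Carrier → D.Carrier) (x : D.Carrier) : Set ℓ where
    field
      fixed : φ x D.≈ x
      least : ∀ y → φ y D.≈ y → x D.≤ y

  module Kleene (⊥ : D.Carrier) (⊥-min : Minimum D._≤_ ⊥)
                (φ : D.Carrier → D.Carrier) (φ-cont : IsContinuous D D φ) where
    private
      module φ = IsContinuous φ-cont

    iterate : ℕ → D.Carrier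
    iterate zero    = ⊥
    iterate (suc n) = φ (iterate n)

    iterates : Chain D.poset
    iterates = record { seq = iterate ; increasing = inc }
      where
      inc : ∀ n → iterate n D.≤ iterate (suc n)
      inc zero    = ⊥-min _
      inc (suc n) = φ.mono (inc n)

    lfp : D.Carrier
    lfp = D.⋁ iterates

    lfp-isLeast : IsLeastFixedPoint φ lfp
    lfp-isLeast = record
      { fixed = D.antisym
          (D.trans (D.reflexive (φ.preserves-⋁ iterates))
            (D.⋁-least _ _ λ n → D.⋁-upper iterates (suc n)))
          (D.⋁-least _ _ below)
      ; least = λ y φy≈y → D.⋁-least _ y (prefixed y (D.reflexive φy≈y))
      }
      where
      below : ∀ n → iterate n D.≤ φ lfp
      below zero    = ⊥-min _
      below (suc n) = φ.mono (D.⋁-upper iterates n)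

      prefixed : ∀ y → φ y D.≤ y → ∀ n → iterate n D.≤ y
      prefixed y h zero    = ⊥-min y
      prefixed y h (suc n) = D.trans (φ.mono (prefixed y h n)) h

module LeastSolution (H : Functor ℓ) (lc : LocallyContinuous H)
                     {A : CPO ℓ} (a : F₀ H A ⇒ A)
                     (⊥ : Carrier A) (⊥-min : Minimum (CPO._≤_ A) ⊥) where
  private
    module A = CPO A

  -- The solutions of d are the fixed points of solutionStep d.
  solutionStep : {X : CPO ℓ} → (X ⇒ F₀ H X ⊕ A) → (X ⇒ A) → (X ⇒ A)
  solutionStep d s = [ a , id ] ∘ (F₁ H s ⊕₁ id) ∘ d

  solutionStep-continuous : {X : CPO ℓ} (d : X ⇒ F₀ H X ⊕ A) →
                            IsContinuous [ X ⇨ A ] [ X ⇨ A ] (solutionStep d)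
  solutionStep-continuous {X} d =
    mkContinuous [ X ⇨ A ] [ X ⇨ A ] (solutionStep d) step-mono step-⋁
    where
    module Hom = CPO [ X ⇨ A ]
    module LC = IsContinuous (lc X A)

    body : (X ⇒ A) → (F₀ H X ⊕ A ⇒ A)
    body s = [ a , id ] ∘ (F₁ H s ⊕₁ id)

    step-mono : solutionStep d Preserves Hom._≤_ ⟶ Hom._≤_
    step-mono {s} {t} s≤t x = body-mono (d ⟨$⟩ x)
      where
      body-mono : ∀ v → (body s ⟨$⟩ v) A.≤ (body t ⟨$⟩ v)
      body-mono (inj₁ h) = mono a (LC.mono s≤t h)
      body-mono (inj₂ y) = A.refl

    step-⋁ : ∀ c → solutionStep d (Hom.⋁ c) Hom.≤
                   Hom.⋁ (mapChain [ X ⇨ A ] [ X ⇨ A ] (solutionStep d) step-mono c)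
    step-⋁ c x = body-⋁ (d ⟨$⟩ x) (λ n → A.⋁-upper _ n)
      where
      body-⋁ : ∀ v {y} → (∀ n → (body (seq c n) ⟨$⟩ v) A.≤ y) → (body (Hom.⋁ c) ⟨$⟩ v) A.≤ y
      body-⋁ (inj₁ h) bound =
        A.trans (A.reflexive (cong a (LC.preserves-⋁ c h)))
        (A.trans (A.reflexive (preserves-⋁ a _)) (A.⋁-least _ _ bound))
      body-⋁ (inj₂ y) bound = bound 0

  ⊥-hom : {X : CPO ℓ} → X ⇒ A
  ⊥-hom .to _ = ⊥
  ⊥-hom {X} .isContinuous =
    mkContinuous X A _ (λ _ → A.refl) (λ _ → ⊥-min _)

  infix 10 _*
  _* : {X : CPO ℓ} → (X ⇒ F₀ H X ⊕ A) → (X ⇒ A)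
  _* {X} d = Kleene.lfp [ X ⇨ A ] ⊥-hom (λ _ _ → ⊥-min _)
    (solutionStep d) (solutionStep-continuous d)

  *-isLeast : {X : CPO ℓ} (d : X ⇒ F₀ H X ⊕ A) →
              IsLeastFixedPoint [ X ⇨ A ] (solutionStep d) (d *)
  *-isLeast {X} d = Kleene.lfp-isLeast [ X ⇨ A ] ⊥-hom (λ _ _ → ⊥-min _)
    (solutionStep d) (solutionStep-continuous d)

  evaluation : (it : Iteratable H) → CompletelyIterativeMonad.T₀ H it A ⇒ A
  evaluation it = CompletelyIterativeMonad.α H it A *

F-square : (F : Functor ℓ) {W X Y Z : CPO ℓ}
           (p : X ⇒ Z) (q : W ⇒ X) (r : Y ⇒ Z) (s : W ⇒ Y) →
           p ∘ q ≈ r ∘ s → F₁ F p ∘ F₁ F q ≈ F₁ F r ∘ F₁ F s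
F-square F {Z = Z} p q r s p∘q≈r∘s x = begin
  F₁ F p ⟨$⟩ F₁ F q ⟨$⟩ x  ≈⟨ homomorphism F {f = q} {g = p} x ⟨
  F₁ F (p ∘ q) ⟨$⟩ x       ≈⟨ F-resp-≈ F {f = p ∘ q} {g = r ∘ s} p∘q≈r∘s x ⟩
  F₁ F (r ∘ s) ⟨$⟩ x       ≈⟨ homomorphism F {f = s} {g = r} x ⟩
  F₁ F r ⟨$⟩ F₁ F s ⟨$⟩ x  ∎
  where open SetoidReasoning (CPO.setoid (F₀ F Z))

F-triangle : (F : Functor ℓ) {X Y Z : CPO ℓ}
             (p : Y ⇒ Z) (q : X ⇒ Y) (r : X ⇒ Z) →
             p ∘ q ≈ r → F₁ F p ∘ F₁ F q ≈ F₁ F r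
F-triangle F {Z = Z} p q r p∘q≈r x = CPO.Eq.trans (F₀ F Z)
  (CPO.Eq.sym (F₀ F Z) (homomorphism F {f = q} {g = p} x))
  (F-resp-≈ F {f = p ∘ q} {g = r} p∘q≈r x)

F-identity : (F : Functor ℓ) {X Y : CPO ℓ} (p : Y ⇒ X) (q : X ⇒ Y) →
             p ∘ q ≈ id → F₁ F p ∘ F₁ F q ≈ id
F-identity F {X} p q p∘q≈id x = CPO.Eq.trans (F₀ F X)
  (F-triangle F p q id p∘q≈id x) (identity F x)

module Scheme {ℓ : Level} (H V : Functor ℓ) (it : Iteratable (H +F V)) where
  open CompletelyIterativeMonad (H +F V) it public

  private
    HV : Functor ℓ
    HV = H +F V

    module H X = CPO (F₀ H X)
    module S X = CPO (T₀ X)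

  record Guarded (e : V ⟹ T) : Set (lsuc ℓ) where
    field
      factor  : V ⟹ H ∘F T
      factors : ∀ X → at e X ≈ τ X ∘ inl ∘ at factor X

  -- With S = T(H+V), MF is HS + Id; M-mult is its multiplication, written
  -- out on the summands HS(HS + Id) and HS + Id.
  MF : Functor ℓ
  MF = (H ∘F T) +F Id

  ρ : ∀ X → F₀ MF X ⇒ T₀ X
  ρ X = [ μ X ∘ κ (T₀ X) ∘ inl , η X ]

  M-mult : ∀ X → F₀ MF (F₀ MF X) ⇒ F₀ MF X
  M-mult X = [ inl ∘ F₁ H (μ X) ∘ F₁ H (T₁ (ρ X)) , id ]

  ρ-inl : ∀ X → ρ X ∘ inl ≈ τ X ∘ inl
  ρ-inl X h = begin
    μ X ⟨$⟩ τ (T₀ X) ⟨$⟩ inj₁ (F₁ H (η (T₀ X)) ⟨$⟩ h)  ≈⟨ μ-τ X (inj₁ (F₁ H (η (T₀ X)) ⟨$⟩ h)) ⟩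
    τ X ⟨$⟩ inj₁ (F₁ H (μ X) ⟨$⟩ F₁ H (η (T₀ X)) ⟨$⟩ h) ≈⟨ cong (τ X) (inj₁ (F-identity H (μ X) (η (T₀ X)) (μ-η X) h)) ⟩
    τ X ⟨$⟩ inj₁ h                                    ∎
    where open SetoidReasoning (S.setoid X)

  ρ-natural : ∀ {X Y} (p : X ⇒ Y) → ρ Y ∘ F₁ MF p ≈ T₁ p ∘ ρ X
  ρ-natural {X} {Y} p (inj₁ h) = begin
    ρ Y ⟨$⟩ inj₁ (F₁ H (T₁ p) ⟨$⟩ h)  ≈⟨ ρ-inl Y (F₁ H (T₁ p) ⟨$⟩ h) ⟩
    τ Y ⟨$⟩ inj₁ (F₁ H (T₁ p) ⟨$⟩ h)  ≈⟨ T₁-τ p (inj₁ h) ⟨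
    T₁ p ⟨$⟩ τ X ⟨$⟩ inj₁ h           ≈⟨ cong (T₁ p) (ρ-inl X h) ⟨
    T₁ p ⟨$⟩ ρ X ⟨$⟩ inj₁ h           ∎
    where open SetoidReasoning (S.setoid Y)
  ρ-natural {X} {Y} p (inj₂ x) = S.Eq.sym Y (T₁-η p x)

  σ : ∀ X → T₀ (F₀ MF X) ⇒ T₀ X
  σ X = μ X ∘ T₁ (ρ X)

  σ-τ : ∀ X → σ X ∘ τ (F₀ MF X) ≈ τ X ∘ F₁ HV (σ X)
  σ-τ X = ∘-τ (μ X) (T₁ (ρ X)) (μ-τ X) (T₁-τ (ρ X))

  σ-η : ∀ X → σ X ∘ η (F₀ MF X) ≈ ρ X
  σ-η X v = S.Eq.trans X (cong (μ X) (T₁-η (ρ X) v)) (μ-η X (ρ X ⟨$⟩ v))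

  mult-inl : ∀ X → F₁ H (μ X) ∘ F₁ H (T₁ (ρ X)) ≈ F₁ H (σ X)
  mult-inl X = F-triangle H (μ X) (T₁ (ρ X)) (σ X) (λ _ → S.Eq.refl X)

  σ-natural : ∀ {X Y} (p : X ⇒ Y) → σ Y ∘ T₁ (F₁ MF p) ≈ T₁ p ∘ σ X
  σ-natural {X} {Y} p = ♯-unique₂ (σ Y ∘ T₁ (F₁ MF p)) (T₁ p ∘ σ X)
    (∘-τ (σ Y) (T₁ (F₁ MF p)) (σ-τ Y) (T₁-τ (F₁ MF p)))
    (∘-τ (T₁ p) (σ X) (T₁-τ p) (σ-τ X))
    λ v → begin
      σ Y ⟨$⟩ T₁ (F₁ MF p) ⟨$⟩ η (F₀ MF X) ⟨$⟩ v  ≈⟨ cong (σ Y) (T₁-η (F₁ MF p) v) ⟩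
      σ Y ⟨$⟩ η (F₀ MF Y) ⟨$⟩ F₁ MF p ⟨$⟩ v       ≈⟨ σ-η Y (F₁ MF p ⟨$⟩ v) ⟩
      ρ Y ⟨$⟩ F₁ MF p ⟨$⟩ v                      ≈⟨ ρ-natural p v ⟩
      T₁ p ⟨$⟩ ρ X ⟨$⟩ v                         ≈⟨ cong (T₁ p) (σ-η X v) ⟨
      T₁ p ⟨$⟩ σ X ⟨$⟩ η (F₀ MF X) ⟨$⟩ v          ∎
    where open SetoidReasoning (S.setoid Y)

  ρ-mult : ∀ X → ρ X ∘ M-mult X ≈ σ X ∘ ρ (F₀ MF X)
  ρ-mult X (inj₁ h) = begin
    ρ X ⟨$⟩ inj₁ (F₁ H (μ X) ⟨$⟩ F₁ H (T₁ (ρ X)) ⟨$⟩ h)  ≈⟨ cong (ρ X) (inj₁ (mult-inl X h)) ⟩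
    ρ X ⟨$⟩ inj₁ (F₁ H (σ X) ⟨$⟩ h)                     ≈⟨ ρ-inl X (F₁ H (σ X) ⟨$⟩ h) ⟩
    τ X ⟨$⟩ inj₁ (F₁ H (σ X) ⟨$⟩ h)                     ≈⟨ σ-τ X (inj₁ h) ⟨
    σ X ⟨$⟩ τ (F₀ MF X) ⟨$⟩ inj₁ h                      ≈⟨ cong (σ X) (ρ-inl (F₀ MF X) h) ⟨
    σ X ⟨$⟩ ρ (F₀ MF X) ⟨$⟩ inj₁ h                      ∎
    where open SetoidReasoning (S.setoid X)
  ρ-mult X (inj₂ v) = S.Eq.sym X (σ-η X v)

  σ-mult : ∀ X → σ X ∘ T₁ (M-mult X) ≈ σ X ∘ σ (F₀ MF X)
  σ-mult X = ♯-unique₂ (σ X ∘ T₁ (M-mult X)) (σ X ∘ σ (F₀ MF X))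
    (∘-τ (σ X) (T₁ (M-mult X)) (σ-τ X) (T₁-τ (M-mult X)))
    (∘-τ (σ X) (σ (F₀ MF X)) (σ-τ X) (σ-τ (F₀ MF X)))
    λ v → begin
      σ X ⟨$⟩ T₁ (M-mult X) ⟨$⟩ η (F₀ MF (F₀ MF X)) ⟨$⟩ v  ≈⟨ cong (σ X) (T₁-η (M-mult X) v) ⟩
      σ X ⟨$⟩ η (F₀ MF X) ⟨$⟩ M-mult X ⟨$⟩ v              ≈⟨ σ-η X (M-mult X ⟨$⟩ v) ⟩
      ρ X ⟨$⟩ M-mult X ⟨$⟩ v                             ≈⟨ ρ-mult X v ⟩
      σ X ⟨$⟩ ρ (F₀ MF X) ⟨$⟩ v                          ≈⟨ cong (σ X) (σ-η (F₀ MF X) v) ⟨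
      σ X ⟨$⟩ σ (F₀ MF X) ⟨$⟩ η (F₀ MF (F₀ MF X)) ⟨$⟩ v   ∎
    where open SetoidReasoning (S.setoid X)

  σ-inr : ∀ X → σ X ∘ T₁ inr ≈ id
  σ-inr X = ♯-unique₂ (σ X ∘ T₁ inr) id
    (∘-τ (σ X) (T₁ inr) (σ-τ X) (T₁-τ inr)) id-τ
    λ x → S.Eq.trans X (cong (σ X) (T₁-η inr x)) (σ-η X (inj₂ x))

  M-unitN : Id ⟹ MF
  M-unitN = record
    { at      = λ _ → inr
    ; natural = λ {_} {Y} _ _ → CPO.Eq.refl (F₀ MF Y)
    }

  M-multN : MF ∘F MF ⟹ MF
  M-multN = record { at = M-mult ; natural = nat }
    where
    nat : ∀ {X Y} (p : X ⇒ Y) → M-mult Y ∘ F₁ MF (F₁ MF p) ≈ F₁ MF p ∘ M-mult X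
    nat {X} {Y} p (inj₁ h) = inj₁ (begin
      F₁ H (μ Y) ⟨$⟩ F₁ H (T₁ (ρ Y)) ⟨$⟩ F₁ H (T₁ (F₁ MF p)) ⟨$⟩ h
        ≈⟨ mult-inl Y (F₁ H (T₁ (F₁ MF p)) ⟨$⟩ h) ⟩
      F₁ H (σ Y) ⟨$⟩ F₁ H (T₁ (F₁ MF p)) ⟨$⟩ h
        ≈⟨ F-square H (σ Y) (T₁ (F₁ MF p)) (T₁ p) (σ X) (σ-natural p) h ⟩
      F₁ H (T₁ p) ⟨$⟩ F₁ H (σ X) ⟨$⟩ h
        ≈⟨ cong (F₁ H (T₁ p)) (mult-inl X h) ⟨
      F₁ H (T₁ p) ⟨$⟩ F₁ H (μ X) ⟨$⟩ F₁ H (T₁ (ρ X)) ⟨$⟩ h ∎)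
      where open SetoidReasoning (H.setoid (T₀ Y))
    nat {X} {Y} p (inj₂ v) = CPO.Eq.refl (F₀ MF Y)

  M : Monad ℓ
  M = record
    { functor   = MF
    ; unit      = M-unitN
    ; mult      = M-multN
    ; assoc     = M-assoc
    ; identityˡ = M-identityˡ
    ; identityʳ = λ X _ → CPO.Eq.refl (F₀ MF X)
    }
    where
    M-assoc : ∀ X → M-mult X ∘ F₁ MF (M-mult X) ≈ M-mult X ∘ M-mult (F₀ MF X)
    M-assoc X (inj₁ h) = inj₁ (begin
      F₁ H (μ X) ⟨$⟩ F₁ H (T₁ (ρ X)) ⟨$⟩ F₁ H (T₁ (M-mult X)) ⟨$⟩ h
        ≈⟨ mult-inl X (F₁ H (T₁ (M-mult X)) ⟨$⟩ h) ⟩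
      F₁ H (σ X) ⟨$⟩ F₁ H (T₁ (M-mult X)) ⟨$⟩ h
        ≈⟨ F-square H (σ X) (T₁ (M-mult X)) (σ X) (σ (F₀ MF X)) (σ-mult X) h ⟩
      F₁ H (σ X) ⟨$⟩ F₁ H (σ (F₀ MF X)) ⟨$⟩ h
        ≈⟨ cong (F₁ H (σ X)) (mult-inl (F₀ MF X) h) ⟨
      F₁ H (σ X) ⟨$⟩ h′
        ≈⟨ mult-inl X h′ ⟨
      F₁ H (μ X) ⟨$⟩ F₁ H (T₁ (ρ X)) ⟨$⟩ h′ ∎)
      where
      open SetoidReasoning (H.setoid (T₀ X))
      h′ = F₁ H (μ (F₀ MF X)) ⟨$⟩ F₁ H (T₁ (ρ (F₀ MF X))) ⟨$⟩ h
    M-assoc X (inj₂ v) = CPO.Eq.refl (F₀ MF X)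

    M-identityˡ : ∀ X → M-mult X ∘ F₁ MF inr ≈ id
    M-identityˡ X (inj₁ h) = inj₁ (H.Eq.trans (T₀ X)
      (mult-inl X (F₁ H (T₁ inr) ⟨$⟩ h)) (F-identity H (σ X) (T₁ inr) (σ-inr X) h))
    M-identityˡ X (inj₂ x) = inj₂ (CPO.Eq.refl X)

  Extends : V ⟹ H ∘F T → MonadMorphism monad M → Set (lsuc ℓ)
  Extends f m = ∀ X → MonadMorphism.at m X ∘ κ X ≈ inl ∘ [ F₁ H (η X) , at f X ]

  module Extension (f : V ⟹ H ∘F T) where
    -- The equations, for fixed r, of q = μ · S(q·η): it expands by f the
    -- outermost V-operations of a term of terms, and sends variables along r.
    record Substitutes {A B : CPO ℓ} (r : A ⇒ T₀ B) (q : T₀ (T₀ A) ⇒ T₀ B) : Set ℓ where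
      field
        on-τ  : q ∘ τ (T₀ A) ≈ τ B ∘ F₁ HV q
        on-η  : q ∘ η (T₀ A) ∘ η A ≈ r
        on-τˡ : q ∘ η (T₀ A) ∘ τ A ∘ inl ≈ τ B ∘ inl ∘ F₁ H (q ∘ η (T₀ A))
        on-τʳ : q ∘ η (T₀ A) ∘ τ A ∘ inr ≈ τ B ∘ inl ∘ F₁ H q ∘ at f (T₀ A)

    open Substitutes

    module _ {A B : CPO ℓ} (r : A ⇒ T₀ B) where
      SSA : CPO ℓ
      SSA = T₀ (T₀ A)

      inner : F₀ HV (T₀ A) ⊕ A ⇒ F₀ HV SSA ⊕ T₀ B
      inner = [ inl ∘ inl ∘ [ F₁ H (η (T₀ A)) , at f (T₀ A) ] , inr ∘ r ]

      outer : F₀ HV SSA ⊕ T₀ A ⇒ F₀ HV SSA ⊕ T₀ B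
      outer = [ inl , inner ∘ α A ]

      equation : SSA ⇒ F₀ HV SSA ⊕ T₀ B
      equation = outer ∘ α (T₀ A)

      expand : SSA ⇒ T₀ B
      expand = Solve.solve equation

      step : (SSA ⇒ T₀ B) → (F₀ HV SSA ⊕ T₀ B ⇒ T₀ B)
      step q = [ τ B , id ] ∘ (F₁ HV q ⊕₁ id)

      expand-τ : expand ∘ τ (T₀ A) ≈ τ B ∘ F₁ HV expand
      expand-τ h = S.Eq.trans B (Solve.solves equation (τ (T₀ A) ⟨$⟩ h))
        (cong (step expand ∘ outer) (α-τ (T₀ A) h))

      expand-η : expand ∘ η (T₀ A) ≈ step expand ∘ inner ∘ α A
      expand-η s = S.Eq.trans B (Solve.solves equation (η (T₀ A) ⟨$⟩ s))
        (cong (step expand ∘ outer) (α-η (T₀ A) s))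

      expand-substitutes : Substitutes r expand
      expand-substitutes .on-τ = expand-τ
      expand-substitutes .on-η x = S.Eq.trans B (expand-η (η A ⟨$⟩ x))
        (cong (step expand ∘ inner) (α-η A x))
      expand-substitutes .on-τˡ h = begin
        expand ⟨$⟩ η (T₀ A) ⟨$⟩ τ A ⟨$⟩ inj₁ h               ≈⟨ expand-η (τ A ⟨$⟩ inj₁ h) ⟩
        step expand ⟨$⟩ inner ⟨$⟩ α A ⟨$⟩ τ A ⟨$⟩ inj₁ h     ≈⟨ cong (step expand ∘ inner) (α-τ A (inj₁ h)) ⟩
        τ B ⟨$⟩ inj₁ (F₁ H expand ⟨$⟩ F₁ H (η (T₀ A)) ⟨$⟩ h) ≈⟨ cong (τ B) (inj₁ (H.Eq.sym (T₀ B) (homomorphism H {f = η (T₀ A)} {g = expand} h))) ⟩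
        τ B ⟨$⟩ inj₁ (F₁ H (expand ∘ η (T₀ A)) ⟨$⟩ h)        ∎
        where open SetoidReasoning (S.setoid B)
      expand-substitutes .on-τʳ v = S.Eq.trans B (expand-η (τ A ⟨$⟩ inj₂ v))
        (cong (step expand ∘ inner) (α-τ A (inj₂ v)))

      expand-unique : (q : SSA ⇒ T₀ B) → Substitutes r q → q ≈ expand
      expand-unique q sub = Solve.unique equation q
        (α⁻¹-cases q (step q ∘ equation)
          (λ h → S.Eq.trans B (on-τ sub h)
            (S.Eq.sym B (cong (step q ∘ outer) (α-τ (T₀ A) h))))
          (λ s → S.Eq.trans B (on-terms s)
            (S.Eq.sym B (cong (step q ∘ outer) (α-η (T₀ A) s)))))
        where
        on-τ-cases : q ∘ η (T₀ A) ∘ τ A ≈ step q ∘ inner ∘ inl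
        on-τ-cases (inj₁ h) = S.Eq.trans B (on-τˡ sub h)
          (cong (τ B) (inj₁ (homomorphism H {f = η (T₀ A)} {g = q} h)))
        on-τ-cases (inj₂ v) = on-τʳ sub v

        on-terms : q ∘ η (T₀ A) ≈ step q ∘ inner ∘ α A
        on-terms = α⁻¹-cases (q ∘ η (T₀ A)) (step q ∘ inner ∘ α A)
          (λ h → S.Eq.trans B (on-τ-cases h)
            (S.Eq.sym B (cong (step q ∘ inner) (α-τ A h))))
          (λ x → S.Eq.trans B (on-η sub x)
            (S.Eq.sym B (cong (step q ∘ inner) (α-η A x))))

      substitutes-unique : (p q : SSA ⇒ T₀ B) → Substitutes r p → Substitutes r q → p ≈ q
      substitutes-unique p q hp hq s =
        S.Eq.trans B (expand-unique p hp s) (S.Eq.sym B (expand-unique q hq s))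

    K : ∀ A → T₀ (T₀ A) ⇒ T₀ A
    K A = expand (η A)

    K-sub : ∀ A → Substitutes (η A) (K A)
    K-sub A = expand-substitutes (η A)

    k : ∀ A → T₀ A ⇒ T₀ A
    k A = K A ∘ η (T₀ A)

    K-natural : ∀ {A B} (p : A ⇒ B) → K B ∘ T₁ (T₁ p) ≈ T₁ p ∘ K A
    K-natural {A} {B} p = substitutes-unique (η B ∘ p)
      (K B ∘ T₁ (T₁ p)) (T₁ p ∘ K A) lhs rhs
      where
      open SetoidReasoning (S.setoid B)

      SSp-η : T₁ (T₁ p) ∘ η (T₀ A) ≈ η (T₀ B) ∘ T₁ p
      SSp-η = T₁-η (T₁ p)

      k-SSp : k B ∘ T₁ p ≈ (K B ∘ T₁ (T₁ p)) ∘ η (T₀ A)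
      k-SSp s = S.Eq.sym B (cong (K B) (SSp-η s))

      lhs : Substitutes (η B ∘ p) (K B ∘ T₁ (T₁ p))
      lhs .on-τ = ∘-τ (K B) (T₁ (T₁ p)) (on-τ (K-sub B)) (T₁-τ (T₁ p))
      lhs .on-η x = begin
        K B ⟨$⟩ T₁ (T₁ p) ⟨$⟩ η (T₀ A) ⟨$⟩ η A ⟨$⟩ x  ≈⟨ cong (K B) (SSp-η (η A ⟨$⟩ x)) ⟩
        k B ⟨$⟩ T₁ p ⟨$⟩ η A ⟨$⟩ x                   ≈⟨ cong (k B) (T₁-η p x) ⟩
        k B ⟨$⟩ η B ⟨$⟩ p ⟨$⟩ x                      ≈⟨ on-η (K-sub B) (p ⟨$⟩ x) ⟩
        η B ⟨$⟩ p ⟨$⟩ x                              ∎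
      lhs .on-τˡ h = begin
        K B ⟨$⟩ T₁ (T₁ p) ⟨$⟩ η (T₀ A) ⟨$⟩ τ A ⟨$⟩ inj₁ h  ≈⟨ cong (K B) (SSp-η (τ A ⟨$⟩ inj₁ h)) ⟩
        k B ⟨$⟩ T₁ p ⟨$⟩ τ A ⟨$⟩ inj₁ h                   ≈⟨ cong (k B) (T₁-τ p (inj₁ h)) ⟩
        k B ⟨$⟩ τ B ⟨$⟩ inj₁ (F₁ H (T₁ p) ⟨$⟩ h)          ≈⟨ on-τˡ (K-sub B) (F₁ H (T₁ p) ⟨$⟩ h) ⟩
        τ B ⟨$⟩ inj₁ (F₁ H (k B) ⟨$⟩ F₁ H (T₁ p) ⟨$⟩ h)   ≈⟨ cong (τ B) (inj₁ (F-triangle H (k B) (T₁ p) ((K B ∘ T₁ (T₁ p)) ∘ η (T₀ A)) k-SSp h)) ⟩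
        τ B ⟨$⟩ inj₁ (F₁ H ((K B ∘ T₁ (T₁ p)) ∘ η (T₀ A)) ⟨$⟩ h) ∎
      lhs .on-τʳ v = begin
        K B ⟨$⟩ T₁ (T₁ p) ⟨$⟩ η (T₀ A) ⟨$⟩ τ A ⟨$⟩ inj₂ v  ≈⟨ cong (K B) (SSp-η (τ A ⟨$⟩ inj₂ v)) ⟩
        k B ⟨$⟩ T₁ p ⟨$⟩ τ A ⟨$⟩ inj₂ v                   ≈⟨ cong (k B) (T₁-τ p (inj₂ v)) ⟩
        k B ⟨$⟩ τ B ⟨$⟩ inj₂ (F₁ V (T₁ p) ⟨$⟩ v)          ≈⟨ on-τʳ (K-sub B) (F₁ V (T₁ p) ⟨$⟩ v) ⟩
        τ B ⟨$⟩ inj₁ (F₁ H (K B) ⟨$⟩ at f (T₀ B) ⟨$⟩ F₁ V (T₁ p) ⟨$⟩ v)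
          ≈⟨ cong (τ B) (inj₁ (cong (F₁ H (K B)) (natural f (T₁ p) v))) ⟩
        τ B ⟨$⟩ inj₁ (F₁ H (K B) ⟨$⟩ F₁ H (T₁ (T₁ p)) ⟨$⟩ at f (T₀ A) ⟨$⟩ v)
          ≈⟨ cong (τ B) (inj₁ (F-triangle H (K B) (T₁ (T₁ p)) (K B ∘ T₁ (T₁ p)) (λ _ → S.Eq.refl B) (at f (T₀ A) ⟨$⟩ v))) ⟩
        τ B ⟨$⟩ inj₁ (F₁ H (K B ∘ T₁ (T₁ p)) ⟨$⟩ at f (T₀ A) ⟨$⟩ v) ∎

      rhs : Substitutes (η B ∘ p) (T₁ p ∘ K A)
      rhs .on-τ = ∘-τ (T₁ p) (K A) (T₁-τ p) (on-τ (K-sub A))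
      rhs .on-η x = S.Eq.trans B (cong (T₁ p) (on-η (K-sub A) x)) (T₁-η p x)
      rhs .on-τˡ h = begin
        T₁ p ⟨$⟩ k A ⟨$⟩ τ A ⟨$⟩ inj₁ h                 ≈⟨ cong (T₁ p) (on-τˡ (K-sub A) h) ⟩
        T₁ p ⟨$⟩ τ A ⟨$⟩ inj₁ (F₁ H (k A) ⟨$⟩ h)        ≈⟨ T₁-τ p (inj₁ (F₁ H (k A) ⟨$⟩ h)) ⟩
        τ B ⟨$⟩ inj₁ (F₁ H (T₁ p) ⟨$⟩ F₁ H (k A) ⟨$⟩ h) ≈⟨ cong (τ B) (inj₁ (F-triangle H (T₁ p) (k A) ((T₁ p ∘ K A) ∘ η (T₀ A)) (λ _ → S.Eq.refl B) h)) ⟩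
        τ B ⟨$⟩ inj₁ (F₁ H ((T₁ p ∘ K A) ∘ η (T₀ A)) ⟨$⟩ h) ∎
      rhs .on-τʳ v = begin
        T₁ p ⟨$⟩ k A ⟨$⟩ τ A ⟨$⟩ inj₂ v                 ≈⟨ cong (T₁ p) (on-τʳ (K-sub A) v) ⟩
        T₁ p ⟨$⟩ τ A ⟨$⟩ inj₁ (F₁ H (K A) ⟨$⟩ at f (T₀ A) ⟨$⟩ v) ≈⟨ T₁-τ p (inj₁ (F₁ H (K A) ⟨$⟩ at f (T₀ A) ⟨$⟩ v)) ⟩
        τ B ⟨$⟩ inj₁ (F₁ H (T₁ p) ⟨$⟩ F₁ H (K A) ⟨$⟩ at f (T₀ A) ⟨$⟩ v)
          ≈⟨ cong (τ B) (inj₁ (F-triangle H (T₁ p) (K A) (T₁ p ∘ K A) (λ _ → S.Eq.refl B) (at f (T₀ A) ⟨$⟩ v))) ⟩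
        τ B ⟨$⟩ inj₁ (F₁ H (T₁ p ∘ K A) ⟨$⟩ at f (T₀ A) ⟨$⟩ v) ∎

    k-natural : ∀ {A B} (p : A ⇒ B) → k B ∘ T₁ p ≈ T₁ p ∘ k A
    k-natural {A} {B} p s = S.Eq.trans B
      (S.Eq.sym B (cong (K B) (T₁-η (T₁ p) s))) (K-natural p (η (T₀ A) ⟨$⟩ s))

    K-mult : ∀ A → K A ∘ T₁ (μ A) ≈ K A ∘ K (T₀ A)
    K-mult A = substitutes-unique (k A) (K A ∘ T₁ (μ A)) (K A ∘ K (T₀ A)) lhs rhs
      where
      open SetoidReasoning (S.setoid A)

      SA = T₀ A

      k-Sμ : k A ∘ μ A ≈ (K A ∘ T₁ (μ A)) ∘ η (T₀ SA)
      k-Sμ s = S.Eq.sym A (cong (K A) (T₁-η (μ A) s))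

      lhs : Substitutes (k A) (K A ∘ T₁ (μ A))
      lhs .on-τ = ∘-τ (K A) (T₁ (μ A)) (on-τ (K-sub A)) (T₁-τ (μ A))
      lhs .on-η s = S.Eq.trans A (cong (K A) (T₁-η (μ A) (η SA ⟨$⟩ s)))
        (cong (k A) (μ-η A s))
      lhs .on-τˡ h = begin
        K A ⟨$⟩ T₁ (μ A) ⟨$⟩ η (T₀ SA) ⟨$⟩ τ SA ⟨$⟩ inj₁ h  ≈⟨ cong (K A) (T₁-η (μ A) (τ SA ⟨$⟩ inj₁ h)) ⟩
        k A ⟨$⟩ μ A ⟨$⟩ τ SA ⟨$⟩ inj₁ h                    ≈⟨ cong (k A) (μ-τ A (inj₁ h)) ⟩
        k A ⟨$⟩ τ A ⟨$⟩ inj₁ (F₁ H (μ A) ⟨$⟩ h)            ≈⟨ on-τˡ (K-sub A) (F₁ H (μ A) ⟨$⟩ h) ⟩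
        τ A ⟨$⟩ inj₁ (F₁ H (k A) ⟨$⟩ F₁ H (μ A) ⟨$⟩ h)     ≈⟨ cong (τ A) (inj₁ (F-triangle H (k A) (μ A) ((K A ∘ T₁ (μ A)) ∘ η (T₀ SA)) k-Sμ h)) ⟩
        τ A ⟨$⟩ inj₁ (F₁ H ((K A ∘ T₁ (μ A)) ∘ η (T₀ SA)) ⟨$⟩ h) ∎
      lhs .on-τʳ v = begin
        K A ⟨$⟩ T₁ (μ A) ⟨$⟩ η (T₀ SA) ⟨$⟩ τ SA ⟨$⟩ inj₂ v  ≈⟨ cong (K A) (T₁-η (μ A) (τ SA ⟨$⟩ inj₂ v)) ⟩
        k A ⟨$⟩ μ A ⟨$⟩ τ SA ⟨$⟩ inj₂ v                    ≈⟨ cong (k A) (μ-τ A (inj₂ v)) ⟩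
        k A ⟨$⟩ τ A ⟨$⟩ inj₂ (F₁ V (μ A) ⟨$⟩ v)            ≈⟨ on-τʳ (K-sub A) (F₁ V (μ A) ⟨$⟩ v) ⟩
        τ A ⟨$⟩ inj₁ (F₁ H (K A) ⟨$⟩ at f SA ⟨$⟩ F₁ V (μ A) ⟨$⟩ v)
          ≈⟨ cong (τ A) (inj₁ (cong (F₁ H (K A)) (natural f (μ A) v))) ⟩
        τ A ⟨$⟩ inj₁ (F₁ H (K A) ⟨$⟩ F₁ H (T₁ (μ A)) ⟨$⟩ at f (T₀ SA) ⟨$⟩ v)
          ≈⟨ cong (τ A) (inj₁ (F-triangle H (K A) (T₁ (μ A)) (K A ∘ T₁ (μ A)) (λ _ → S.Eq.refl A) (at f (T₀ SA) ⟨$⟩ v))) ⟩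
        τ A ⟨$⟩ inj₁ (F₁ H (K A ∘ T₁ (μ A)) ⟨$⟩ at f (T₀ SA) ⟨$⟩ v) ∎

      rhs : Substitutes (k A) (K A ∘ K SA)
      rhs .on-τ = ∘-τ (K A) (K SA) (on-τ (K-sub A)) (on-τ (K-sub SA))
      rhs .on-η s = cong (K A) (on-η (K-sub SA) s)
      rhs .on-τˡ h = begin
        K A ⟨$⟩ k SA ⟨$⟩ τ SA ⟨$⟩ inj₁ h                 ≈⟨ cong (K A) (on-τˡ (K-sub SA) h) ⟩
        K A ⟨$⟩ τ SA ⟨$⟩ inj₁ (F₁ H (k SA) ⟨$⟩ h)        ≈⟨ on-τ (K-sub A) (inj₁ (F₁ H (k SA) ⟨$⟩ h)) ⟩
        τ A ⟨$⟩ inj₁ (F₁ H (K A) ⟨$⟩ F₁ H (k SA) ⟨$⟩ h)  ≈⟨ cong (τ A) (inj₁ (F-triangle H (K A) (k SA) ((K A ∘ K SA) ∘ η (T₀ SA)) (λ _ → S.Eq.refl A) h)) ⟩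
        τ A ⟨$⟩ inj₁ (F₁ H ((K A ∘ K SA) ∘ η (T₀ SA)) ⟨$⟩ h) ∎
      rhs .on-τʳ v = begin
        K A ⟨$⟩ k SA ⟨$⟩ τ SA ⟨$⟩ inj₂ v                 ≈⟨ cong (K A) (on-τʳ (K-sub SA) v) ⟩
        K A ⟨$⟩ τ SA ⟨$⟩ inj₁ (F₁ H (K SA) ⟨$⟩ at f (T₀ SA) ⟨$⟩ v) ≈⟨ on-τ (K-sub A) (inj₁ (F₁ H (K SA) ⟨$⟩ at f (T₀ SA) ⟨$⟩ v)) ⟩
        τ A ⟨$⟩ inj₁ (F₁ H (K A) ⟨$⟩ F₁ H (K SA) ⟨$⟩ at f (T₀ SA) ⟨$⟩ v)
          ≈⟨ cong (τ A) (inj₁ (F-triangle H (K A) (K SA) (K A ∘ K SA) (λ _ → S.Eq.refl A) (at f (T₀ SA) ⟨$⟩ v))) ⟩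
        τ A ⟨$⟩ inj₁ (F₁ H (K A ∘ K SA) ⟨$⟩ at f (T₀ SA) ⟨$⟩ v) ∎

    k-mult : ∀ A → k A ∘ μ A ≈ K A ∘ k (T₀ A)
    k-mult A s = S.Eq.trans A
      (S.Eq.sym A (cong (K A) (T₁-η (μ A) s))) (K-mult A (η (T₀ (T₀ A)) ⟨$⟩ s))

    K-Sη : ∀ A → K A ∘ T₁ (η A) ≈ id
    K-Sη A = ♯-unique₂ (K A ∘ T₁ (η A)) id
      (∘-τ (K A) (T₁ (η A)) (on-τ (K-sub A)) (T₁-τ (η A))) id-τ
      (λ x → S.Eq.trans A (cong (K A) (T₁-η (η A) x)) (on-η (K-sub A) x))

    g-α⁻¹ : ∀ A → F₀ HV (T₀ A) ⊕ A ⇒ F₀ MF A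
    g-α⁻¹ A = [ inl ∘ [ F₁ H (k A) , F₁ H (K A) ∘ at f (T₀ A) ] , inr ]

    g : ∀ A → T₀ A ⇒ F₀ MF A
    g A = g-α⁻¹ A ∘ α A

    g-τ : ∀ A → g A ∘ τ A ≈ inl ∘ [ F₁ H (k A) , F₁ H (K A) ∘ at f (T₀ A) ]
    g-τ A h = cong (g-α⁻¹ A) (α-τ A h)

    g-η : ∀ A → g A ∘ η A ≈ inr
    g-η A x = cong (g-α⁻¹ A) (α-η A x)

    ρ-g : ∀ A → ρ A ∘ g A ≈ k A
    ρ-g A = α⁻¹-cases (ρ A ∘ g A) (k A) onτ onη
      where
      onτ : (ρ A ∘ g A) ∘ τ A ≈ k A ∘ τ A
      onτ (inj₁ h) = S.Eq.trans A (cong (ρ A) (g-τ A (inj₁ h)))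
        (S.Eq.trans A (ρ-inl A (F₁ H (k A) ⟨$⟩ h)) (S.Eq.sym A (on-τˡ (K-sub A) h)))
      onτ (inj₂ v) = S.Eq.trans A (cong (ρ A) (g-τ A (inj₂ v)))
        (S.Eq.trans A (ρ-inl A (F₁ H (K A) ⟨$⟩ at f (T₀ A) ⟨$⟩ v)) (S.Eq.sym A (on-τʳ (K-sub A) v)))

      onη : (ρ A ∘ g A) ∘ η A ≈ k A ∘ η A
      onη x = S.Eq.trans A (cong (ρ A) (g-η A x)) (S.Eq.sym A (on-η (K-sub A) x))

    σ-g : ∀ A → σ A ∘ T₁ (g A) ≈ K A
    σ-g A = ♯-unique₂ (σ A ∘ T₁ (g A)) (K A)
      (∘-τ (σ A) (T₁ (g A)) (σ-τ A) (T₁-τ (g A))) (on-τ (K-sub A))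
      λ s → begin
        σ A ⟨$⟩ T₁ (g A) ⟨$⟩ η (T₀ A) ⟨$⟩ s  ≈⟨ cong (σ A) (T₁-η (g A) s) ⟩
        σ A ⟨$⟩ η (F₀ MF A) ⟨$⟩ g A ⟨$⟩ s    ≈⟨ σ-η A (g A ⟨$⟩ s) ⟩
        ρ A ⟨$⟩ g A ⟨$⟩ s                   ≈⟨ ρ-g A s ⟩
        k A ⟨$⟩ s                           ∎
      where open SetoidReasoning (S.setoid A)

    g-natural : ∀ {A B} (p : A ⇒ B) → g B ∘ T₁ p ≈ F₁ MF p ∘ g A
    g-natural {A} {B} p = α⁻¹-cases (g B ∘ T₁ p) (F₁ MF p ∘ g A) onτ onη
      where
      open SetoidReasoning (CPO.setoid (F₀ MF B))

      onτ : (g B ∘ T₁ p) ∘ τ A ≈ (F₁ MF p ∘ g A) ∘ τ A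
      onτ (inj₁ h) = begin
        g B ⟨$⟩ T₁ p ⟨$⟩ τ A ⟨$⟩ inj₁ h            ≈⟨ cong (g B) (T₁-τ p (inj₁ h)) ⟩
        g B ⟨$⟩ τ B ⟨$⟩ inj₁ (F₁ H (T₁ p) ⟨$⟩ h)   ≈⟨ g-τ B (inj₁ (F₁ H (T₁ p) ⟨$⟩ h)) ⟩
        inj₁ (F₁ H (k B) ⟨$⟩ F₁ H (T₁ p) ⟨$⟩ h)    ≈⟨ inj₁ (F-square H (k B) (T₁ p) (T₁ p) (k A) (k-natural p) h) ⟩
        inj₁ (F₁ H (T₁ p) ⟨$⟩ F₁ H (k A) ⟨$⟩ h)    ≈⟨ cong (F₁ MF p) (g-τ A (inj₁ h)) ⟨
        F₁ MF p ⟨$⟩ g A ⟨$⟩ τ A ⟨$⟩ inj₁ h         ∎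
      onτ (inj₂ v) = begin
        g B ⟨$⟩ T₁ p ⟨$⟩ τ A ⟨$⟩ inj₂ v            ≈⟨ cong (g B) (T₁-τ p (inj₂ v)) ⟩
        g B ⟨$⟩ τ B ⟨$⟩ inj₂ (F₁ V (T₁ p) ⟨$⟩ v)   ≈⟨ g-τ B (inj₂ (F₁ V (T₁ p) ⟨$⟩ v)) ⟩
        inj₁ (F₁ H (K B) ⟨$⟩ at f (T₀ B) ⟨$⟩ F₁ V (T₁ p) ⟨$⟩ v)
          ≈⟨ inj₁ (cong (F₁ H (K B)) (natural f (T₁ p) v)) ⟩
        inj₁ (F₁ H (K B) ⟨$⟩ F₁ H (T₁ (T₁ p)) ⟨$⟩ at f (T₀ A) ⟨$⟩ v)
          ≈⟨ inj₁ (F-square H (K B) (T₁ (T₁ p)) (T₁ p) (K A) (K-natural p) (at f (T₀ A) ⟨$⟩ v)) ⟩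
        inj₁ (F₁ H (T₁ p) ⟨$⟩ F₁ H (K A) ⟨$⟩ at f (T₀ A) ⟨$⟩ v)
          ≈⟨ cong (F₁ MF p) (g-τ A (inj₂ v)) ⟨
        F₁ MF p ⟨$⟩ g A ⟨$⟩ τ A ⟨$⟩ inj₂ v         ∎

      onη : (g B ∘ T₁ p) ∘ η A ≈ (F₁ MF p ∘ g A) ∘ η A
      onη x = begin
        g B ⟨$⟩ T₁ p ⟨$⟩ η A ⟨$⟩ x     ≈⟨ cong (g B) (T₁-η p x) ⟩
        g B ⟨$⟩ η B ⟨$⟩ p ⟨$⟩ x        ≈⟨ g-η B (p ⟨$⟩ x) ⟩
        inj₂ (p ⟨$⟩ x)                 ≈⟨ cong (F₁ MF p) (g-η A x) ⟨
        F₁ MF p ⟨$⟩ g A ⟨$⟩ η A ⟨$⟩ x  ∎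

    g-mult : ∀ A → g A ∘ μ A ≈ M-mult A ∘ F₁ MF (g A) ∘ g (T₀ A)
    g-mult A = α⁻¹-cases (g A ∘ μ A) (M-mult A ∘ F₁ MF (g A) ∘ g (T₀ A)) onτ onη
      where
      open SetoidReasoning (CPO.setoid (F₀ MF A))

      SA = T₀ A

      onτ : (g A ∘ μ A) ∘ τ SA ≈ (M-mult A ∘ F₁ MF (g A) ∘ g SA) ∘ τ SA
      mult-g : ∀ h → CPO._≈_ (F₀ MF A)
                       (inj₁ (F₁ H (K A) ⟨$⟩ h))
                       (M-mult A ⟨$⟩ F₁ MF (g A) ⟨$⟩ inj₁ h)
      mult-g h = inj₁ (H.Eq.sym SA (H.Eq.trans SA
        (mult-inl A (F₁ H (T₁ (g A)) ⟨$⟩ h))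
        (F-triangle H (σ A) (T₁ (g A)) (K A) (σ-g A) h)))

      onτ (inj₁ h) = begin
        g A ⟨$⟩ μ A ⟨$⟩ τ SA ⟨$⟩ inj₁ h            ≈⟨ cong (g A) (μ-τ A (inj₁ h)) ⟩
        g A ⟨$⟩ τ A ⟨$⟩ inj₁ (F₁ H (μ A) ⟨$⟩ h)    ≈⟨ g-τ A (inj₁ (F₁ H (μ A) ⟨$⟩ h)) ⟩
        inj₁ (F₁ H (k A) ⟨$⟩ F₁ H (μ A) ⟨$⟩ h)     ≈⟨ inj₁ (F-square H (k A) (μ A) (K A) (k SA) (k-mult A) h) ⟩
        inj₁ (F₁ H (K A) ⟨$⟩ F₁ H (k SA) ⟨$⟩ h)    ≈⟨ mult-g (F₁ H (k SA) ⟨$⟩ h) ⟩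
        M-mult A ⟨$⟩ F₁ MF (g A) ⟨$⟩ inj₁ (F₁ H (k SA) ⟨$⟩ h)
          ≈⟨ cong (M-mult A ∘ F₁ MF (g A)) (g-τ SA (inj₁ h)) ⟨
        M-mult A ⟨$⟩ F₁ MF (g A) ⟨$⟩ g SA ⟨$⟩ τ SA ⟨$⟩ inj₁ h ∎
      onτ (inj₂ v) = begin
        g A ⟨$⟩ μ A ⟨$⟩ τ SA ⟨$⟩ inj₂ v            ≈⟨ cong (g A) (μ-τ A (inj₂ v)) ⟩
        g A ⟨$⟩ τ A ⟨$⟩ inj₂ (F₁ V (μ A) ⟨$⟩ v)    ≈⟨ g-τ A (inj₂ (F₁ V (μ A) ⟨$⟩ v)) ⟩
        inj₁ (F₁ H (K A) ⟨$⟩ at f SA ⟨$⟩ F₁ V (μ A) ⟨$⟩ v)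
          ≈⟨ inj₁ (cong (F₁ H (K A)) (natural f (μ A) v)) ⟩
        inj₁ (F₁ H (K A) ⟨$⟩ F₁ H (T₁ (μ A)) ⟨$⟩ at f (T₀ SA) ⟨$⟩ v)
          ≈⟨ inj₁ (F-square H (K A) (T₁ (μ A)) (K A) (K SA) (K-mult A) (at f (T₀ SA) ⟨$⟩ v)) ⟩
        inj₁ (F₁ H (K A) ⟨$⟩ F₁ H (K SA) ⟨$⟩ at f (T₀ SA) ⟨$⟩ v)
          ≈⟨ mult-g (F₁ H (K SA) ⟨$⟩ at f (T₀ SA) ⟨$⟩ v) ⟩
        M-mult A ⟨$⟩ F₁ MF (g A) ⟨$⟩ inj₁ (F₁ H (K SA) ⟨$⟩ at f (T₀ SA) ⟨$⟩ v)
          ≈⟨ cong (M-mult A ∘ F₁ MF (g A)) (g-τ SA (inj₂ v)) ⟨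
        M-mult A ⟨$⟩ F₁ MF (g A) ⟨$⟩ g SA ⟨$⟩ τ SA ⟨$⟩ inj₂ v ∎

      onη : (g A ∘ μ A) ∘ η SA ≈ (M-mult A ∘ F₁ MF (g A) ∘ g SA) ∘ η SA
      onη s = begin
        g A ⟨$⟩ μ A ⟨$⟩ η SA ⟨$⟩ s                              ≈⟨ cong (g A) (μ-η A s) ⟩
        g A ⟨$⟩ s                                              ≈⟨ cong (M-mult A ∘ F₁ MF (g A)) (g-η SA s) ⟨
        M-mult A ⟨$⟩ F₁ MF (g A) ⟨$⟩ g SA ⟨$⟩ η SA ⟨$⟩ s        ∎

    extension : MonadMorphism monad M
    extension = record
      { transformation = record { at = g ; natural = g-natural }
      ; preserves-unit = g-η
      ; preserves-mult = g-mult
      }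

    extension-extends : Extends f extension
    extension-extends A (inj₁ h) = CPO.Eq.trans (F₀ MF A)
      (g-τ A (inj₁ (F₁ H (η A) ⟨$⟩ h)))
      (inj₁ (F-triangle H (k A) (η A) (η A) (on-η (K-sub A)) h))
    extension-extends A (inj₂ v) = begin
      g A ⟨$⟩ τ A ⟨$⟩ inj₂ (F₁ V (η A) ⟨$⟩ v)             ≈⟨ g-τ A (inj₂ (F₁ V (η A) ⟨$⟩ v)) ⟩
      inj₁ (F₁ H (K A) ⟨$⟩ at f (T₀ A) ⟨$⟩ F₁ V (η A) ⟨$⟩ v)
        ≈⟨ inj₁ (cong (F₁ H (K A)) (natural f (η A) v)) ⟩
      inj₁ (F₁ H (K A) ⟨$⟩ F₁ H (T₁ (η A)) ⟨$⟩ at f A ⟨$⟩ v)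
        ≈⟨ inj₁ (F-identity H (K A) (T₁ (η A)) (K-Sη A) (at f A ⟨$⟩ v)) ⟩
      inj₁ (at f A ⟨$⟩ v) ∎
      where open SetoidReasoning (CPO.setoid (F₀ MF A))

    extension-unique : (m : MonadMorphism monad M) → Extends f m →
                       ∀ A → MonadMorphism.at m A ≈ g A
    extension-unique m ext A =
      α⁻¹-cases (m.at A) (g A) onτ
        (λ x → CPO.Eq.trans (F₀ MF A) (m.preserves-unit A x)
                 (CPO.Eq.sym (F₀ MF A) (g-η A x)))
      where
      module m = MonadMorphism m
      open SetoidReasoning (CPO.setoid (F₀ MF A))

      SA = T₀ A

      k′ : SA ⇒ SA
      k′ = ρ A ∘ m.at A

      K′ : T₀ SA ⇒ SA
      K′ = σ A ∘ T₁ (m.at A)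

      K′-η : K′ ∘ η SA ≈ k′
      K′-η s = S.Eq.trans A (cong (σ A) (T₁-η (m.at A) s)) (σ-η A (m.at A ⟨$⟩ s))

      mult-m : ∀ h → CPO._≈_ (F₀ MF A)
                       (M-mult A ⟨$⟩ F₁ MF (m.at A) ⟨$⟩ inj₁ h)
                       (inj₁ (F₁ H K′ ⟨$⟩ h))
      mult-m h = inj₁ (H.Eq.trans SA
        (mult-inl A (F₁ H (T₁ (m.at A)) ⟨$⟩ h))
        (F-triangle H (σ A) (T₁ (m.at A)) K′ (λ _ → S.Eq.refl A) h))

      μκ : ∀ h → CPO._≈_ SA (τ A ⟨$⟩ h) (μ A ⟨$⟩ κ SA ⟨$⟩ h)
      μκ h = S.Eq.sym A (S.Eq.trans A (μ-τ A (F₁ HV (η SA) ⟨$⟩ h))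
        (cong (τ A) (F-identity HV (μ A) (η SA) (μ-η A) h)))

      m-τ : m.at A ∘ τ A ≈ inl ∘ F₁ H K′ ∘ [ F₁ H (η SA) , at f SA ]
      m-τ h = begin
        m.at A ⟨$⟩ τ A ⟨$⟩ h                                       ≈⟨ cong (m.at A) (μκ h) ⟩
        m.at A ⟨$⟩ μ A ⟨$⟩ κ SA ⟨$⟩ h                              ≈⟨ m.preserves-mult A (κ SA ⟨$⟩ h) ⟩
        M-mult A ⟨$⟩ F₁ MF (m.at A) ⟨$⟩ m.at SA ⟨$⟩ κ SA ⟨$⟩ h     ≈⟨ cong (M-mult A ∘ F₁ MF (m.at A)) (ext SA h) ⟩
        M-mult A ⟨$⟩ F₁ MF (m.at A) ⟨$⟩ inj₁ ([ F₁ H (η SA) , at f SA ] ⟨$⟩ h)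
          ≈⟨ mult-m ([ F₁ H (η SA) , at f SA ] ⟨$⟩ h) ⟩
        inj₁ (F₁ H K′ ⟨$⟩ [ F₁ H (η SA) , at f SA ] ⟨$⟩ h)         ∎

      k′-τ : k′ ∘ τ A ≈ τ A ∘ inl ∘ F₁ H K′ ∘ [ F₁ H (η SA) , at f SA ]
      k′-τ h = S.Eq.trans A (cong (ρ A) (m-τ h))
        (ρ-inl A (F₁ H K′ ⟨$⟩ [ F₁ H (η SA) , at f SA ] ⟨$⟩ h))

      K′-sub : Substitutes (η A) K′
      K′-sub .on-τ = ∘-τ (σ A) (T₁ (m.at A)) (σ-τ A) (T₁-τ (m.at A))
      K′-sub .on-η x = S.Eq.trans A (K′-η (η A ⟨$⟩ x)) (cong (ρ A) (m.preserves-unit A x))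
      K′-sub .on-τˡ h = S.Eq.trans A (K′-η (τ A ⟨$⟩ inj₁ h)) (S.Eq.trans A (k′-τ (inj₁ h))
        (cong (τ A) (inj₁ (F-triangle H K′ (η SA) (K′ ∘ η SA) (λ _ → S.Eq.refl A) h))))
      K′-sub .on-τʳ v = S.Eq.trans A (K′-η (τ A ⟨$⟩ inj₂ v)) (k′-τ (inj₂ v))

      K′≈K : K′ ≈ K A
      K′≈K = expand-unique (η A) K′ K′-sub

      onτ : m.at A ∘ τ A ≈ g A ∘ τ A
      onτ (inj₁ h) = begin
        m.at A ⟨$⟩ τ A ⟨$⟩ inj₁ h               ≈⟨ m-τ (inj₁ h) ⟩
        inj₁ (F₁ H K′ ⟨$⟩ F₁ H (η SA) ⟨$⟩ h)    ≈⟨ inj₁ (F-triangle H K′ (η SA) (k A) (λ s → K′≈K (η SA ⟨$⟩ s)) h) ⟩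
        inj₁ (F₁ H (k A) ⟨$⟩ h)                 ≈⟨ g-τ A (inj₁ h) ⟨
        g A ⟨$⟩ τ A ⟨$⟩ inj₁ h                  ∎
      onτ (inj₂ v) = begin
        m.at A ⟨$⟩ τ A ⟨$⟩ inj₂ v               ≈⟨ m-τ (inj₂ v) ⟩
        inj₁ (F₁ H K′ ⟨$⟩ at f SA ⟨$⟩ v)        ≈⟨ inj₁ (F-resp-≈ H {f = K′} {g = K A} K′≈K (at f SA ⟨$⟩ v)) ⟩
        inj₁ (F₁ H (K A) ⟨$⟩ at f SA ⟨$⟩ v)     ≈⟨ g-τ A (inj₂ v) ⟨
        g A ⟨$⟩ τ A ⟨$⟩ inj₂ v                  ∎

  ∃!-extension : (f : V ⟹ H ∘F T) →
    Σ[ m ∈ MonadMorphism monad M ]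
      (Extends f m ×
       (∀ m′ → Extends f m′ → ∀ A → MonadMorphism.at m′ A ≈ MonadMorphism.at m A))
  ∃!-extension f = extension , extension-extends , extension-unique
    where open Extension f

module Interpretation {ℓ : Level} (H V : Functor ℓ) (it : Iteratable (H +F V))
                      (H-lc : LocallyContinuous H) (HV-lc : LocallyContinuous (H +F V))
                      {A : CPO ℓ} (a : F₀ H A ⇒ A)
                      (⊥ : Carrier A) (⊥-min : Minimum (CPO._≤_ A) ⊥) where
  open Scheme H V it

  R : V ⟹ T → (F₀ V A ⇒ A) → (F₀ V A ⇒ A)
  R e f = LeastSolution.evaluation (H +F V) HV-lc [ a , f ] ⊥ ⊥-min it ∘ at e A

  -- The factor f of e is determined by e, and ē by f.
  standardSolution : (e : V ⟹ T) → Guarded e → (F₀ V A ⇒ A)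
  standardSolution e guarded = ē * ∘ κ A ∘ inr
    where
    open LeastSolution H H-lc a ⊥ ⊥-min using (_*)

    ē : T₀ A ⇒ F₀ H (T₀ A) ⊕ A
    ē = MonadMorphism.at (proj₁ (∃!-extension (Guarded.factor guarded))) A

{-# OPTIONS --safe #-}
-- Write S = T(H+V), let φ : V → HS be the factor of e, and let h = (ē_A)*,
-- with Kleene approximants hₙ.  Let k : SA → SA expand the outermost
-- V-operations of a term by φ, and let K = μ · Sk.  By induction on n, hₙ is
-- invariant under expansion:  hₙ · k = hₙ and hₙ · K = hₙ · μ.
-- Hence h satisfies
--   h · τ · inl = a · Hh   and   h · τ · inr = a · H(h · μ) · φ,
-- so that the standard solution is a · Hh · φ, and the approximants satisfy
-- analogous equations.  On the other hand R f = a · H[a,f]~ · φ, where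
-- [a,f]~ · μ ≤ [a,f]~ · S[a,f]~.
--   * If R f ≤ f, these equations give hₙ ≤ [a,f]~ by induction, so the
--     standard solution lies below R f.
--   * Similarly hₙ · Sh ≤ h · μ, so h solves the equations of
--     [a , standard solution]~ up to ≤, and the standard solution is a
--     prefixed point of R.
-- Being below R f for each prefixed point f, it is a least fixed point.
module Submission where

open import Level using (Level)
open import Data.Nat.Base using (ℕ; zero; suc; _+_)
open import Data.Nat.Properties using (+-comm)
open import Data.Product.Base using (_×_; _,_)
open import Data.Sum.Base using (inj₁; inj₂)
open import Relation.Binary.Definitions using (Minimum)
open import Relation.Binary.PropositionalEquality.Core using (subst)
import Relation.Binary.Reasoning.PartialOrder as PosetReasoning
import Relation.Binary.Reasoning.Setoid as SetoidReasoning
open import Defs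

private
  variable
    ℓ : Level

-- The pointwise order on morphisms, and joins of chains.

infix 4 _⊑_
_⊑_ : {X Y : CPO ℓ} → (X ⇒ Y) → (X ⇒ Y) → Set ℓ
_⊑_ {X = X} {Y} = CPO._≤_ [ X ⇨ Y ]

F₁-mono : (F : Functor ℓ) → LocallyContinuous F →
          {X Y : CPO ℓ} (p q : X ⇒ Y) → p ⊑ q → F₁ F p ⊑ F₁ F q
F₁-mono F lc {X} {Y} p q = IsContinuous.mono (lc X Y) {p} {q}

-- Lax counterpart of `F-square`. It carries an induction hypothesis about approximants under the
-- functor.
F-square-⊑ : (F : Functor ℓ) → LocallyContinuous F → {W X Y Z : CPO ℓ}
             (p : X ⇒ Z) (q : W ⇒ X) (r : Y ⇒ Z) (s : W ⇒ Y) →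
             p ∘ q ⊑ r ∘ s → F₁ F p ∘ F₁ F q ⊑ F₁ F r ∘ F₁ F s
F-square-⊑ F lc {Z = Z} p q r s p∘q⊑r∘s x = begin
  F₁ F p ⟨$⟩ F₁ F q ⟨$⟩ x  ≈⟨ homomorphism F {f = q} {g = p} x ⟨
  F₁ F (p ∘ q) ⟨$⟩ x       ≤⟨ F₁-mono F lc (p ∘ q) (r ∘ s) p∘q⊑r∘s x ⟩
  F₁ F (r ∘ s) ⟨$⟩ x       ≈⟨ homomorphism F {f = s} {g = r} x ⟩
  F₁ F r ⟨$⟩ F₁ F s ⟨$⟩ x  ∎
  where open PosetReasoning (CPO.poset (F₀ F Z))

module _ (X : CPO ℓ) where
  private
    module X = CPO X

  chain-≤ : (c : Chain X.poset) → ∀ m n → seq c n X.≤ seq c (m + n)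
  chain-≤ c zero    n = X.refl
  chain-≤ c (suc m) n = X.trans (chain-≤ c m n) (increasing c (m + n))

  chain-≤ʳ : (c : Chain X.poset) → ∀ m n → seq c m X.≤ seq c (m + n)
  chain-≤ʳ c m n = subst (λ i → seq c m X.≤ seq c i) (+-comm n m) (chain-≤ c n m)

-- Both chains increase, so the entry with indices `m` and `n` lies below the diagonal entry at
-- `m + n`.
pointwise-⋁-diagonal : (X Y : CPO ℓ) (c : Chain (homPoset X Y)) (d : Chain (CPO.poset X)) →
                       ∀ y → (∀ n → CPO._≤_ Y (seq c n ⟨$⟩ seq d n) y) →
                       CPO._≤_ Y (pointwise-⋁ X Y c ⟨$⟩ CPO.⋁ X d) y
pointwise-⋁-diagonal X Y c d y bound = Y.⋁-least _ y λ m →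
  Y.trans (Y.reflexive (preserves-⋁ (seq c m) d)) (Y.⋁-least _ y λ n →
    Y.trans (mono (seq c m) (chain-≤ X d m n))
      (Y.trans (chain-≤ʳ [ X ⇨ Y ] c m n (seq d (m + n))) (bound (m + n))))
  where module Y = CPO Y

-- Least solutions and their Kleene approximants.

module LeastSolutionProperties
    (H : Functor ℓ) (lc : LocallyContinuous H) {A : CPO ℓ} (a : F₀ H A ⇒ A)
    (⊥ : CPO.Carrier A) (⊥-min : Minimum (CPO._≤_ A) ⊥) where
  open LeastSolution H lc a ⊥ ⊥-min public

  private
    module A = CPO A

  -- The part of `solutionStep d s` after `d`, named so that `cong` can rewrite the value of `d`
  -- inside it.
  algebra+id : {X : CPO ℓ} → (X ⇒ A) → (F₀ H X ⊕ A ⇒ A)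
  algebra+id s = [ a , id ] ∘ (F₁ H s ⊕₁ id)

  module _ {X : CPO ℓ} (d : X ⇒ F₀ H X ⊕ A) where
    private
      module Step = IsContinuous (solutionStep-continuous d)
      module Iteration = Kleene [ X ⇨ A ] ⊥-hom (λ _ _ → ⊥-min _)
                           (solutionStep d) (solutionStep-continuous d)

    approximant : ℕ → X ⇒ A
    approximant = Iteration.iterate

    approximant-⊑ : ∀ n → approximant n ⊑ d *
    approximant-⊑ = CPO.⋁-upper [ X ⇨ A ] Iteration.iterates

    -- Joins of morphisms are pointwise, so the test can be made at a single point. The inductions
    -- that bound a least solution from above start here.
    *-⊑ : ∀ {x y} → (∀ n → (approximant n ⟨$⟩ x) A.≤ y) → (d * ⟨$⟩ x) A.≤ y
    *-⊑ = A.⋁-least _ _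

    *-solves : d * ≈ solutionStep d (d *)
    *-solves x = A.Eq.sym (IsLeastFixedPoint.fixed (*-isLeast d) x)

    -- Extends `*-isLeast` from fixed to prefixed points: monotonicity keeps each iterate of `⊥`
    -- below `s`.
    *-prefixed : (s : X ⇒ A) → solutionStep d s ⊑ s → d * ⊑ s
    *-prefixed s s-pre x = *-⊑ λ n → below n x
      where
      below : ∀ n → approximant n ⊑ s
      below zero    _ = ⊥-min _
      below (suc n) y = A.trans (Step.mono {approximant n} {s} (below n) y) (s-pre y)

    *-equalizes : {W : CPO ℓ} (p q : W ⇒ X) →
                  (∀ n → approximant n ∘ p ≈ approximant n ∘ q) → d * ∘ p ≈ d * ∘ q
    *-equalizes p q eq w = A.antisym
      (*-⊑ λ n → A.trans (A.reflexive (eq n w)) (approximant-⊑ n (q ⟨$⟩ w)))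
      (*-⊑ λ n → A.trans (A.reflexive (A.Eq.sym (eq n w))) (approximant-⊑ n (p ⟨$⟩ w)))

-- Evaluation of terms.

module _ (H : Functor ℓ) (it : Iteratable H) where
  open CompletelyIterativeMonad H it

  -- Since `α⁻¹` is surjective up to `≈`, every term is an operation or a variable.
  α⁻¹-cases-⊑ : ∀ {X Z} (p q : T₀ X ⇒ Z) → p ∘ τ X ⊑ q ∘ τ X → p ∘ η X ⊑ q ∘ η X → p ⊑ q
  α⁻¹-cases-⊑ {X} {Z} p q pτ pη t = begin
    p ⟨$⟩ t                    ≈⟨ cong p (α⁻¹∘α X t) ⟨
    p ⟨$⟩ α⁻¹ X ⟨$⟩ α X ⟨$⟩ t  ≤⟨ on (α X ⟨$⟩ t) ⟩
    q ⟨$⟩ α⁻¹ X ⟨$⟩ α X ⟨$⟩ t  ≈⟨ cong q (α⁻¹∘α X t) ⟩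
    q ⟨$⟩ t                    ∎
    where
    open PosetReasoning (CPO.poset Z)

    on : p ∘ α⁻¹ X ⊑ q ∘ α⁻¹ X
    on (inj₁ h) = pτ h
    on (inj₂ x) = pη x

module Evaluation
    (H : Functor ℓ) (lc : LocallyContinuous H) (it : Iteratable H) {A : CPO ℓ}
    (⊥ : CPO.Carrier A) (⊥-min : Minimum (CPO._≤_ A) ⊥) where
  open CompletelyIterativeMonad H it

  private
    module A = CPO A

  module _ (a : F₀ H A ⇒ A) where
    open LeastSolutionProperties H lc a ⊥ ⊥-min

    ev : T₀ A ⇒ A
    ev = evaluation it

    step-τ : (s : T₀ A ⇒ A) → solutionStep (α A) s ∘ τ A ≈ a ∘ F₁ H s
    step-τ s h = cong (algebra+id s) (α-τ A h)

    step-η : (s : T₀ A ⇒ A) → solutionStep (α A) s ∘ η A ≈ id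
    step-η s x = cong (algebra+id s) (α-η A x)

    ev-τ : ev ∘ τ A ≈ a ∘ F₁ H ev
    ev-τ h = A.Eq.trans (*-solves (α A) (τ A ⟨$⟩ h)) (step-τ ev h)

    ev-η : ev ∘ η A ≈ id
    ev-η x = A.Eq.trans (*-solves (α A) (η A ⟨$⟩ x)) (step-η ev x)

    ev-least : (s : T₀ A ⇒ A) → a ∘ F₁ H s ⊑ s ∘ τ A → id ⊑ s ∘ η A → ev ⊑ s
    ev-least s sτ sη = *-prefixed (α A) s (α⁻¹-cases-⊑ H it (solutionStep (α A) s) s
      (λ h → A.trans (A.reflexive (step-τ s h)) (sτ h))
      (λ x → A.trans (A.reflexive (step-η s x)) (sη x)))

    -- Half of the associativity law of an Eilenberg-Moore algebra, by induction on the approximants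
    -- of the left `ev`: at an operation both sides apply `a` to recursive values, and at a variable
    -- an approximant meets `ev` itself.
    ev-μ : ev ∘ μ A ⊑ ev ∘ T₁ ev
    ev-μ t = *-⊑ (α A) λ n → below n t
      where
      E : ℕ → T₀ A ⇒ A
      E = approximant (α A)

      below : ∀ n → E n ∘ μ A ⊑ ev ∘ T₁ ev
      below zero    _ = ⊥-min _
      below (suc n)   = α⁻¹-cases-⊑ H it (E (suc n) ∘ μ A) (ev ∘ T₁ ev) onτ onη
        where
        open PosetReasoning A.poset

        onτ : (E (suc n) ∘ μ A) ∘ τ (T₀ A) ⊑ (ev ∘ T₁ ev) ∘ τ (T₀ A)
        onτ h = begin
          E (suc n) ⟨$⟩ μ A ⟨$⟩ τ (T₀ A) ⟨$⟩ h    ≈⟨ cong (E (suc n)) (μ-τ A h) ⟩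
          E (suc n) ⟨$⟩ τ A ⟨$⟩ F₁ H (μ A) ⟨$⟩ h  ≈⟨ step-τ (E n) (F₁ H (μ A) ⟨$⟩ h) ⟩
          a ⟨$⟩ F₁ H (E n) ⟨$⟩ F₁ H (μ A) ⟨$⟩ h   ≤⟨ mono a (F-square-⊑ H lc (E n) (μ A) ev (T₁ ev) (below n) h) ⟩
          a ⟨$⟩ F₁ H ev ⟨$⟩ F₁ H (T₁ ev) ⟨$⟩ h    ≈⟨ ev-τ (F₁ H (T₁ ev) ⟨$⟩ h) ⟨
          ev ⟨$⟩ τ A ⟨$⟩ F₁ H (T₁ ev) ⟨$⟩ h       ≈⟨ cong ev (T₁-τ ev h) ⟨
          ev ⟨$⟩ T₁ ev ⟨$⟩ τ (T₀ A) ⟨$⟩ h         ∎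

        onη : (E (suc n) ∘ μ A) ∘ η (T₀ A) ⊑ (ev ∘ T₁ ev) ∘ η (T₀ A)
        onη s = begin
          E (suc n) ⟨$⟩ μ A ⟨$⟩ η (T₀ A) ⟨$⟩ s  ≈⟨ cong (E (suc n)) (μ-η A s) ⟩
          E (suc n) ⟨$⟩ s                       ≤⟨ approximant-⊑ (α A) (suc n) s ⟩
          ev ⟨$⟩ s                              ≈⟨ ev-η (ev ⟨$⟩ s) ⟨
          ev ⟨$⟩ η A ⟨$⟩ ev ⟨$⟩ s               ≈⟨ cong ev (T₁-η ev s) ⟨
          ev ⟨$⟩ T₁ ev ⟨$⟩ η (T₀ A) ⟨$⟩ s       ∎

module InterpretationProperties
    (H V : Functor ℓ) (it : Iteratable (H +F V))
    (H-lc : LocallyContinuous H) (V-lc : LocallyContinuous V)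
    (HV-lc : LocallyContinuous (H +F V))
    {A : CPO ℓ} (a : F₀ H A ⇒ A)
    (⊥ : CPO.Carrier A) (⊥-min : Minimum (CPO._≤_ A) ⊥) where
  open Scheme H V it
  open Interpretation H V it H-lc HV-lc a ⊥ ⊥-min

  private
    module A = CPO A
    module Ev = Evaluation (H +F V) HV-lc it {A} ⊥ ⊥-min
    HV = H +F V
    VA = F₀ V A
    SA = T₀ A
    Hom = [ VA ⇨ A ]
    module Hom = CPO Hom

  -- Continuity of `R`.

  ev : (VA ⇒ A) → (SA ⇒ A)
  ev f = Ev.ev [ a , f ]

  -- By `ev-least`: `ev f′` satisfies the equations of `ev f` up to `≤`, as it interprets
  -- V-operations by the larger `f′`.
  ev-mono : (f f′ : VA ⇒ A) → f ⊑ f′ → ev f ⊑ ev f′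
  ev-mono f f′ f⊑f′ = Ev.ev-least [ a , f ] (ev f′) onτ
    (λ x → A.reflexive (A.Eq.sym (Ev.ev-η [ a , f′ ] x)))
    where
    onτ : [ a , f ] ∘ F₁ HV (ev f′) ⊑ ev f′ ∘ τ A
    onτ (inj₁ h) = A.reflexive (A.Eq.sym (Ev.ev-τ [ a , f′ ] (inj₁ h)))
    onτ (inj₂ v) = A.trans (f⊑f′ (F₁ V (ev f′) ⟨$⟩ v))
      (A.reflexive (A.Eq.sym (Ev.ev-τ [ a , f′ ] (inj₂ v))))

  evChain : Chain Hom.poset → Chain (homPoset SA A)
  evChain c = record
    { seq        = λ n → ev (seq c n)
    ; increasing = λ n → ev-mono (seq c n) (seq c (suc n)) (increasing c n)
    }

  -- By `ev-least` again. An H-operation needs one join, moved out by local continuity of `H`. A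
  -- V-operation needs two, of the interpretations and of the evaluated arguments, which the
  -- diagonal merges.
  ev-⋁ : ∀ c → ev (Hom.⋁ c) ⊑ pointwise-⋁ SA A (evChain c)
  ev-⋁ c = Ev.ev-least [ a , Hom.⋁ c ] E onτ onη
    where
    open PosetReasoning A.poset

    E : SA ⇒ A
    E = pointwise-⋁ SA A (evChain c)

    E-upper : ∀ n → ev (seq c n) ⊑ E
    E-upper = CPO.⋁-upper [ SA ⇨ A ] (evChain c)

    F₁-chain : (F : Functor ℓ) → LocallyContinuous F → Chain (homPoset (F₀ F SA) (F₀ F A))
    F₁-chain F lc = mapChain [ SA ⇨ A ] [ F₀ F SA ⇨ F₀ F A ] (F₁ F)
      (IsContinuous.mono (lc SA A)) (evChain c)

    onτ : [ a , Hom.⋁ c ] ∘ F₁ HV E ⊑ E ∘ τ A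
    onτ (inj₁ h) = begin
      a ⟨$⟩ F₁ H E ⟨$⟩ h
        ≈⟨ cong a (IsContinuous.preserves-⋁ (H-lc SA A) (evChain c) h) ⟩
      a ⟨$⟩ CPO.⋁ (F₀ H A) (chainAt (F₀ H SA) (F₀ H A) (F₁-chain H H-lc) h)
        ≈⟨ preserves-⋁ a _ ⟩
      A.⋁ (mapChain (F₀ H A) A (to a) (mono a) (chainAt (F₀ H SA) (F₀ H A) (F₁-chain H H-lc) h))
        ≤⟨ A.⋁-least _ _ (λ n → A.trans
             (A.reflexive (A.Eq.sym (Ev.ev-τ [ a , seq c n ] (inj₁ h))))
             (E-upper n (τ A ⟨$⟩ inj₁ h))) ⟩
      E ⟨$⟩ τ A ⟨$⟩ inj₁ h ∎
    onτ (inj₂ v) = begin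
      Hom.⋁ c ⟨$⟩ F₁ V E ⟨$⟩ v
        ≈⟨ cong (Hom.⋁ c) (IsContinuous.preserves-⋁ (V-lc SA A) (evChain c) v) ⟩
      Hom.⋁ c ⟨$⟩ CPO.⋁ VA (chainAt (F₀ V SA) VA (F₁-chain V V-lc) v)
        ≤⟨ pointwise-⋁-diagonal VA A c (chainAt (F₀ V SA) VA (F₁-chain V V-lc) v) _
             (λ n → A.trans
               (A.reflexive (A.Eq.sym (Ev.ev-τ [ a , seq c n ] (inj₂ v))))
               (E-upper n (τ A ⟨$⟩ inj₂ v))) ⟩
      E ⟨$⟩ τ A ⟨$⟩ inj₂ v ∎

    onη : id ⊑ E ∘ η A
    -- All members of the chain are the identity on variables, so index 0 serves as well as any.
    onη x = A.trans (A.reflexive (A.Eq.sym (Ev.ev-η [ a , seq c 0 ] x)))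
      (E-upper 0 (η A ⟨$⟩ x))

  R-continuous : (e : V ⟹ T) → IsContinuous Hom Hom (R e)
  R-continuous e = mkContinuous Hom Hom (R e)
    (λ {f} {f′} f⊑f′ v → ev-mono f f′ f⊑f′ (at e A ⟨$⟩ v))
    (λ c v → A.trans (ev-⋁ c (at e A ⟨$⟩ v))
      (A.⋁-least _ _ λ n → A.⋁-upper _ n))

  -- Invariance under expansion of V-operations.

  module _ (e : V ⟹ T) (guarded : Guarded e) where
    open Guarded guarded renaming (factor to φ)
    open Extension φ
    open Extension.Substitutes
    open LeastSolutionProperties H H-lc a ⊥ ⊥-min

    -- Guardedness puts an H-operation at the root of `e`, and `ev f` interprets it by `a`.
    R-factor : (f : VA ⇒ A) → R e f ≈ a ∘ F₁ H (ev f) ∘ at φ A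
    R-factor f v = A.Eq.trans (cong (ev f) (factors A v))
      (Ev.ev-τ [ a , f ] (inj₁ (at φ A ⟨$⟩ v)))

    -- Both sides commute with `τ` and restrict to `k A` along `η`. This turns the corecursively
    -- defined `K` into a formula to which the monad laws apply.
    K-μ : K A ≈ μ A ∘ T₁ (k A)
    K-μ = ♯-unique₂ (K A) (μ A ∘ T₁ (k A)) (on-τ (K-sub A))
      (∘-τ (μ A) (T₁ (k A)) (μ-τ A) (T₁-τ (k A)))
      (λ s → CPO.Eq.sym SA (CPO.Eq.trans SA (cong (μ A) (T₁-η (k A) s)) (μ-η A (k A ⟨$⟩ s))))

    Φ : (SA ⇒ A) → (SA ⇒ A)
    Φ = solutionStep (g A)

    Φ-η : (s : SA ⇒ A) → Φ s ∘ η A ≈ id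
    Φ-η s x = cong (algebra+id s) (g-η A x)

    module _ (s : SA ⇒ A) (s∘k : s ∘ k A ≈ s) where
      private
        Φ-τ-k : Φ s ∘ τ A ∘ inl ≈ a ∘ F₁ H s ∘ F₁ H (k A)
        Φ-τ-k h = cong (algebra+id s) (g-τ A (inj₁ h))

      -- `g` expands the arguments of an H-operation by `k`, which the invariance of `s` absorbs.
      Φ-τˡ : Φ s ∘ τ A ∘ inl ≈ a ∘ F₁ H s
      Φ-τˡ h = A.Eq.trans (Φ-τ-k h) (cong a (F-triangle H s (k A) s s∘k h))

      -- `g` itself performs the expansion at the root, so expanding beforehand leads to the same
      -- value of `a`.
      Φ-k : Φ s ∘ k A ≈ Φ s
      Φ-k = α⁻¹-cases (Φ s ∘ k A) (Φ s) onτ onη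
        where
        open SetoidReasoning A.setoid

        onτ : (Φ s ∘ k A) ∘ τ A ≈ Φ s ∘ τ A
        onτ (inj₁ h) = begin
          Φ s ⟨$⟩ k A ⟨$⟩ τ A ⟨$⟩ inj₁ h           ≈⟨ cong (Φ s) (on-τˡ (K-sub A) h) ⟩
          Φ s ⟨$⟩ τ A ⟨$⟩ inj₁ (F₁ H (k A) ⟨$⟩ h)  ≈⟨ Φ-τˡ (F₁ H (k A) ⟨$⟩ h) ⟩
          a ⟨$⟩ F₁ H s ⟨$⟩ F₁ H (k A) ⟨$⟩ h        ≈⟨ Φ-τ-k h ⟨
          Φ s ⟨$⟩ τ A ⟨$⟩ inj₁ h                   ∎
        onτ (inj₂ v) = begin
          Φ s ⟨$⟩ k A ⟨$⟩ τ A ⟨$⟩ inj₂ v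
            ≈⟨ cong (Φ s) (on-τʳ (K-sub A) v) ⟩
          Φ s ⟨$⟩ τ A ⟨$⟩ inj₁ (F₁ H (K A) ⟨$⟩ at φ SA ⟨$⟩ v)
            ≈⟨ Φ-τˡ (F₁ H (K A) ⟨$⟩ at φ SA ⟨$⟩ v) ⟩
          a ⟨$⟩ F₁ H s ⟨$⟩ F₁ H (K A) ⟨$⟩ at φ SA ⟨$⟩ v
            ≈⟨ cong (algebra+id s) (g-τ A (inj₂ v)) ⟨
          Φ s ⟨$⟩ τ A ⟨$⟩ inj₂ v ∎

        onη : (Φ s ∘ k A) ∘ η A ≈ Φ s ∘ η A
        onη x = cong (Φ s) (on-η (K-sub A) x)

      module _ (s∘K : s ∘ K A ≈ s ∘ μ A) where
        Φ-τʳ : Φ s ∘ τ A ∘ inr ≈ a ∘ F₁ H s ∘ F₁ H (μ A) ∘ at φ SA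
        Φ-τʳ v = A.Eq.trans (cong (algebra+id s) (g-τ A (inj₂ v)))
          (cong a (F-square H s (K A) s (μ A) s∘K (at φ SA ⟨$⟩ v)))

        private
          -- With `K` written as in `K-μ`, associativity and naturality of `μ` bring the inner
          -- expansion to the outside, where `s∘K` turns it into `μ`.
          s∘μ∘K : (s ∘ μ A) ∘ T₁ (K A) ≈ (s ∘ μ A) ∘ T₁ (μ A)
          s∘μ∘K t = begin
            s ⟨$⟩ μ A ⟨$⟩ T₁ (K A) ⟨$⟩ t
              ≈⟨ cong (s ∘ μ A) (F-resp-≈ T {f = K A} {g = μ A ∘ T₁ (k A)} K-μ t) ⟩
            s ⟨$⟩ μ A ⟨$⟩ T₁ (μ A ∘ T₁ (k A)) ⟨$⟩ t
              ≈⟨ cong (s ∘ μ A) (homomorphism T {f = T₁ (k A)} {g = μ A} t) ⟩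
            s ⟨$⟩ μ A ⟨$⟩ T₁ (μ A) ⟨$⟩ T₁ (T₁ (k A)) ⟨$⟩ t
              ≈⟨ cong s (Monad.assoc monad A (T₁ (T₁ (k A)) ⟨$⟩ t)) ⟩
            s ⟨$⟩ μ A ⟨$⟩ μ SA ⟨$⟩ T₁ (T₁ (k A)) ⟨$⟩ t
              ≈⟨ cong (s ∘ μ A) (natural μN (k A) t) ⟩
            s ⟨$⟩ μ A ⟨$⟩ T₁ (k A) ⟨$⟩ μ SA ⟨$⟩ t
              ≈⟨ cong s (K-μ (μ SA ⟨$⟩ t)) ⟨
            s ⟨$⟩ K A ⟨$⟩ μ SA ⟨$⟩ t
              ≈⟨ s∘K (μ SA ⟨$⟩ t) ⟩
            s ⟨$⟩ μ A ⟨$⟩ μ SA ⟨$⟩ t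
              ≈⟨ cong s (Monad.assoc monad A t) ⟨
            s ⟨$⟩ μ A ⟨$⟩ T₁ (μ A) ⟨$⟩ t ∎
            where open SetoidReasoning A.setoid

        -- At an H-operation this reduces to `s∘K`, at a variable to `Φ-k`. At a V-operation
        -- naturality of `φ` moves `K` and `μ` inside the terms it produces, where `s∘μ∘K` compares
        -- them.
        Φ-K : Φ s ∘ K A ≈ Φ s ∘ μ A
        Φ-K = α⁻¹-cases (Φ s ∘ K A) (Φ s ∘ μ A) onτ onη
          where
          open SetoidReasoning A.setoid

          onτ : (Φ s ∘ K A) ∘ τ SA ≈ (Φ s ∘ μ A) ∘ τ SA
          onτ (inj₁ h) = begin
            Φ s ⟨$⟩ K A ⟨$⟩ τ SA ⟨$⟩ inj₁ h          ≈⟨ cong (Φ s) (on-τ (K-sub A) (inj₁ h)) ⟩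
            Φ s ⟨$⟩ τ A ⟨$⟩ inj₁ (F₁ H (K A) ⟨$⟩ h)  ≈⟨ Φ-τˡ (F₁ H (K A) ⟨$⟩ h) ⟩
            a ⟨$⟩ F₁ H s ⟨$⟩ F₁ H (K A) ⟨$⟩ h        ≈⟨ cong a (F-square H s (K A) s (μ A) s∘K h) ⟩
            a ⟨$⟩ F₁ H s ⟨$⟩ F₁ H (μ A) ⟨$⟩ h        ≈⟨ Φ-τˡ (F₁ H (μ A) ⟨$⟩ h) ⟨
            Φ s ⟨$⟩ τ A ⟨$⟩ inj₁ (F₁ H (μ A) ⟨$⟩ h)  ≈⟨ cong (Φ s) (μ-τ A (inj₁ h)) ⟨
            Φ s ⟨$⟩ μ A ⟨$⟩ τ SA ⟨$⟩ inj₁ h          ∎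
          onτ (inj₂ v) = begin
            Φ s ⟨$⟩ K A ⟨$⟩ τ SA ⟨$⟩ inj₂ v
              ≈⟨ cong (Φ s) (on-τ (K-sub A) (inj₂ v)) ⟩
            Φ s ⟨$⟩ τ A ⟨$⟩ inj₂ (F₁ V (K A) ⟨$⟩ v)
              ≈⟨ Φ-τʳ-natural (K A) v ⟩
            a ⟨$⟩ F₁ H (s ∘ μ A) ⟨$⟩ F₁ H (T₁ (K A)) ⟨$⟩ at φ (T₀ SA) ⟨$⟩ v
              ≈⟨ cong a (F-square H (s ∘ μ A) (T₁ (K A)) (s ∘ μ A) (T₁ (μ A)) s∘μ∘K (at φ (T₀ SA) ⟨$⟩ v)) ⟩
            a ⟨$⟩ F₁ H (s ∘ μ A) ⟨$⟩ F₁ H (T₁ (μ A)) ⟨$⟩ at φ (T₀ SA) ⟨$⟩ v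
              ≈⟨ Φ-τʳ-natural (μ A) v ⟨
            Φ s ⟨$⟩ τ A ⟨$⟩ inj₂ (F₁ V (μ A) ⟨$⟩ v)
              ≈⟨ cong (Φ s) (μ-τ A (inj₂ v)) ⟨
            Φ s ⟨$⟩ μ A ⟨$⟩ τ SA ⟨$⟩ inj₂ v ∎
            where
            Φ-τʳ-natural : (p : T₀ SA ⇒ SA) →
              Φ s ∘ τ A ∘ inr ∘ F₁ V p
              ≈ a ∘ F₁ H (s ∘ μ A) ∘ F₁ H (T₁ p) ∘ at φ (T₀ SA)
            Φ-τʳ-natural p w = begin
              Φ s ⟨$⟩ τ A ⟨$⟩ inj₂ (F₁ V p ⟨$⟩ w)
                ≈⟨ Φ-τʳ (F₁ V p ⟨$⟩ w) ⟩
              a ⟨$⟩ F₁ H s ⟨$⟩ F₁ H (μ A) ⟨$⟩ at φ SA ⟨$⟩ F₁ V p ⟨$⟩ w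
                ≈⟨ cong a (homomorphism H {f = μ A} {g = s} (at φ SA ⟨$⟩ F₁ V p ⟨$⟩ w)) ⟨
              a ⟨$⟩ F₁ H (s ∘ μ A) ⟨$⟩ at φ SA ⟨$⟩ F₁ V p ⟨$⟩ w
                ≈⟨ cong (a ∘ F₁ H (s ∘ μ A)) (natural φ p w) ⟩
              a ⟨$⟩ F₁ H (s ∘ μ A) ⟨$⟩ F₁ H (T₁ p) ⟨$⟩ at φ (T₀ SA) ⟨$⟩ w ∎

          onη : (Φ s ∘ K A) ∘ η SA ≈ (Φ s ∘ μ A) ∘ η SA
          onη t = A.Eq.trans (Φ-k t) (A.Eq.sym (cong (Φ s) (μ-η A t)))

    hₙ : ℕ → SA ⇒ A
    hₙ = approximant (g A)

    h : SA ⇒ A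
    h = g A *

    -- `hₙ zero` is constantly `⊥`, hence invariant under any precomposition, and `hₙ (suc n)` is
    -- `Φ (hₙ n)`.
    hₙ-k : ∀ n → hₙ n ∘ k A ≈ hₙ n
    hₙ-k zero    _ = A.Eq.refl
    hₙ-k (suc n)   = Φ-k (hₙ n) (hₙ-k n)

    hₙ-K : ∀ n → hₙ n ∘ K A ≈ hₙ n ∘ μ A
    hₙ-K zero    _ = A.Eq.refl
    hₙ-K (suc n)   = Φ-K (hₙ n) (hₙ-k n) (hₙ-K n)

    hₙ-τˡ : ∀ n → hₙ (suc n) ∘ τ A ∘ inl ≈ a ∘ F₁ H (hₙ n)
    hₙ-τˡ n = Φ-τˡ (hₙ n) (hₙ-k n)

    hₙ-τʳ : ∀ n → hₙ (suc n) ∘ τ A ∘ inr ≈ a ∘ F₁ H (hₙ n) ∘ F₁ H (μ A) ∘ at φ SA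
    hₙ-τʳ n = Φ-τʳ (hₙ n) (hₙ-k n) (hₙ-K n)

    h-k : h ∘ k A ≈ h
    h-k = *-equalizes (g A) (k A) id hₙ-k

    h-K : h ∘ K A ≈ h ∘ μ A
    h-K = *-equalizes (g A) (K A) (μ A) hₙ-K

    h-τˡ : h ∘ τ A ∘ inl ≈ a ∘ F₁ H h
    h-τˡ x = A.Eq.trans (*-solves (g A) (τ A ⟨$⟩ inj₁ x)) (Φ-τˡ h h-k x)

    h-τʳ : h ∘ τ A ∘ inr ≈ a ∘ F₁ H h ∘ F₁ H (μ A) ∘ at φ SA
    h-τʳ v = A.Eq.trans (*-solves (g A) (τ A ⟨$⟩ inj₂ v)) (Φ-τʳ h h-k h-K v)

    h-η : h ∘ η A ≈ id
    h-η x = A.Eq.trans (*-solves (g A) (η A ⟨$⟩ x)) (Φ-η h x)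

    -- The standard solution as least prefixed point.

    private
      e‡ : VA ⇒ A
      e‡ = standardSolution e guarded

    -- `κ` turns the arguments of the V-operation into variables by `η`; naturality of `φ` moves
    -- this `η` next to the `μ` of `h-τʳ`, and a unit law cancels the two.
    standardSolution-factor : e‡ ≈ a ∘ F₁ H h ∘ at φ A
    standardSolution-factor v = begin
      h ⟨$⟩ τ A ⟨$⟩ inj₂ (F₁ V (η A) ⟨$⟩ v)
        ≈⟨ h-τʳ (F₁ V (η A) ⟨$⟩ v) ⟩
      a ⟨$⟩ F₁ H h ⟨$⟩ F₁ H (μ A) ⟨$⟩ at φ SA ⟨$⟩ F₁ V (η A) ⟨$⟩ v
        ≈⟨ cong (a ∘ F₁ H h ∘ F₁ H (μ A)) (natural φ (η A) v) ⟩
      a ⟨$⟩ F₁ H h ⟨$⟩ F₁ H (μ A) ⟨$⟩ F₁ H (T₁ (η A)) ⟨$⟩ at φ A ⟨$⟩ v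
        ≈⟨ cong (a ∘ F₁ H h) (F-identity H (μ A) (T₁ (η A)) (Monad.identityˡ monad A) (at φ A ⟨$⟩ v)) ⟩
      a ⟨$⟩ F₁ H h ⟨$⟩ at φ A ⟨$⟩ v ∎
      where open SetoidReasoning A.setoid

    -- At a V-operation `ev-μ` splits the evaluation of the expanded term into two stages. The outer
    -- stage is `R e f` on evaluated arguments, where the hypothesis replaces it by `f`.
    h-⊑-ev : (f : VA ⇒ A) → R e f ⊑ f → h ⊑ ev f
    h-⊑-ev f Rf⊑f t = *-⊑ (g A) λ n → below n t
      where
      E = ev f

      below : ∀ n → hₙ n ⊑ E
      below zero    _ = ⊥-min _
      below (suc n)   = α⁻¹-cases-⊑ HV it (hₙ (suc n)) E onτ onη
        where
        open PosetReasoning A.poset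

        onτ : hₙ (suc n) ∘ τ A ⊑ E ∘ τ A
        onτ (inj₁ x) = begin
          hₙ (suc n) ⟨$⟩ τ A ⟨$⟩ inj₁ x  ≈⟨ hₙ-τˡ n x ⟩
          a ⟨$⟩ F₁ H (hₙ n) ⟨$⟩ x        ≤⟨ mono a (F₁-mono H H-lc (hₙ n) E (below n) x) ⟩
          a ⟨$⟩ F₁ H E ⟨$⟩ x             ≈⟨ Ev.ev-τ [ a , f ] (inj₁ x) ⟨
          E ⟨$⟩ τ A ⟨$⟩ inj₁ x           ∎
        onτ (inj₂ v) = begin
          hₙ (suc n) ⟨$⟩ τ A ⟨$⟩ inj₂ v
            ≈⟨ hₙ-τʳ n v ⟩
          a ⟨$⟩ F₁ H (hₙ n) ⟨$⟩ F₁ H (μ A) ⟨$⟩ at φ SA ⟨$⟩ v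
            ≤⟨ mono a (F₁-mono H H-lc (hₙ n) E (below n) (F₁ H (μ A) ⟨$⟩ at φ SA ⟨$⟩ v)) ⟩
          a ⟨$⟩ F₁ H E ⟨$⟩ F₁ H (μ A) ⟨$⟩ at φ SA ⟨$⟩ v
            ≤⟨ mono a (F-square-⊑ H H-lc E (μ A) E (T₁ E) (Ev.ev-μ [ a , f ]) (at φ SA ⟨$⟩ v)) ⟩
          a ⟨$⟩ F₁ H E ⟨$⟩ F₁ H (T₁ E) ⟨$⟩ at φ SA ⟨$⟩ v
            ≈⟨ cong (a ∘ F₁ H E) (natural φ E v) ⟨
          a ⟨$⟩ F₁ H E ⟨$⟩ at φ A ⟨$⟩ F₁ V E ⟨$⟩ v
            ≈⟨ R-factor f (F₁ V E ⟨$⟩ v) ⟨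
          R e f ⟨$⟩ F₁ V E ⟨$⟩ v
            ≤⟨ Rf⊑f (F₁ V E ⟨$⟩ v) ⟩
          f ⟨$⟩ F₁ V E ⟨$⟩ v
            ≈⟨ Ev.ev-τ [ a , f ] (inj₂ v) ⟨
          E ⟨$⟩ τ A ⟨$⟩ inj₂ v ∎

        onη : hₙ (suc n) ∘ η A ⊑ E ∘ η A
        onη x = A.reflexive (A.Eq.trans (Φ-η (hₙ n) x) (A.Eq.sym (Ev.ev-η [ a , f ] x)))

    -- Bounding by `R e f` instead of `f` pays off at `e‡` itself, where it yields the second
    -- inequality of the fixed-point equation.
    standardSolution-⊑-R : (f : VA ⇒ A) → R e f ⊑ f → e‡ ⊑ R e f
    standardSolution-⊑-R f Rf⊑f v = begin
      e‡ ⟨$⟩ v                            ≈⟨ standardSolution-factor v ⟩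
      a ⟨$⟩ F₁ H h ⟨$⟩ at φ A ⟨$⟩ v       ≤⟨ mono a (F₁-mono H H-lc h (ev f) (h-⊑-ev f Rf⊑f) (at φ A ⟨$⟩ v)) ⟩
      a ⟨$⟩ F₁ H (ev f) ⟨$⟩ at φ A ⟨$⟩ v  ≈⟨ R-factor f v ⟨
      R e f ⟨$⟩ v                         ∎
      where open PosetReasoning A.poset

    -- The direction opposite to `ev-μ`, by induction on the approximants of the outer `h`. At a
    -- V-operation naturality of `φ` and `μ` places `T₁ h` directly under `hₙ n`, as the induction
    -- hypothesis requires; associativity of `μ` then restores the shape of `h-τʳ`.
    h-T₁h : h ∘ T₁ h ⊑ h ∘ μ A
    h-T₁h t = *-⊑ (g A) λ n → below n t
      where
      below : ∀ n → hₙ n ∘ T₁ h ⊑ h ∘ μ A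
      below zero    _ = ⊥-min _
      below (suc n)   = α⁻¹-cases-⊑ HV it (hₙ (suc n) ∘ T₁ h) (h ∘ μ A) onτ onη
        where
        open PosetReasoning A.poset

        onτ : (hₙ (suc n) ∘ T₁ h) ∘ τ SA ⊑ (h ∘ μ A) ∘ τ SA
        onτ (inj₁ x) = begin
          hₙ (suc n) ⟨$⟩ T₁ h ⟨$⟩ τ SA ⟨$⟩ inj₁ x          ≈⟨ cong (hₙ (suc n)) (T₁-τ h (inj₁ x)) ⟩
          hₙ (suc n) ⟨$⟩ τ A ⟨$⟩ inj₁ (F₁ H (T₁ h) ⟨$⟩ x)  ≈⟨ hₙ-τˡ n (F₁ H (T₁ h) ⟨$⟩ x) ⟩
          a ⟨$⟩ F₁ H (hₙ n) ⟨$⟩ F₁ H (T₁ h) ⟨$⟩ x          ≤⟨ mono a (F-square-⊑ H H-lc (hₙ n) (T₁ h) h (μ A) (below n) x) ⟩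
          a ⟨$⟩ F₁ H h ⟨$⟩ F₁ H (μ A) ⟨$⟩ x                ≈⟨ h-τˡ (F₁ H (μ A) ⟨$⟩ x) ⟨
          h ⟨$⟩ τ A ⟨$⟩ inj₁ (F₁ H (μ A) ⟨$⟩ x)            ≈⟨ cong h (μ-τ A (inj₁ x)) ⟨
          h ⟨$⟩ μ A ⟨$⟩ τ SA ⟨$⟩ inj₁ x                    ∎
        onτ (inj₂ v) = begin
          hₙ (suc n) ⟨$⟩ T₁ h ⟨$⟩ τ SA ⟨$⟩ inj₂ v
            ≈⟨ cong (hₙ (suc n)) (T₁-τ h (inj₂ v)) ⟩
          hₙ (suc n) ⟨$⟩ τ A ⟨$⟩ inj₂ (F₁ V (T₁ h) ⟨$⟩ v)
            ≈⟨ hₙ-τʳ n (F₁ V (T₁ h) ⟨$⟩ v) ⟩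
          a ⟨$⟩ F₁ H (hₙ n) ⟨$⟩ F₁ H (μ A) ⟨$⟩ at φ SA ⟨$⟩ F₁ V (T₁ h) ⟨$⟩ v
            ≈⟨ cong (a ∘ F₁ H (hₙ n) ∘ F₁ H (μ A)) (natural φ (T₁ h) v) ⟩
          a ⟨$⟩ F₁ H (hₙ n) ⟨$⟩ F₁ H (μ A) ⟨$⟩ F₁ H (T₁ (T₁ h)) ⟨$⟩ at φ (T₀ SA) ⟨$⟩ v
            ≈⟨ cong (a ∘ F₁ H (hₙ n)) (F-square H (μ A) (T₁ (T₁ h)) (T₁ h) (μ SA) (natural μN h) (at φ (T₀ SA) ⟨$⟩ v)) ⟩
          a ⟨$⟩ F₁ H (hₙ n) ⟨$⟩ F₁ H (T₁ h) ⟨$⟩ F₁ H (μ SA) ⟨$⟩ at φ (T₀ SA) ⟨$⟩ v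
            ≤⟨ mono a (F-square-⊑ H H-lc (hₙ n) (T₁ h) h (μ A) (below n) (F₁ H (μ SA) ⟨$⟩ at φ (T₀ SA) ⟨$⟩ v)) ⟩
          a ⟨$⟩ F₁ H h ⟨$⟩ F₁ H (μ A) ⟨$⟩ F₁ H (μ SA) ⟨$⟩ at φ (T₀ SA) ⟨$⟩ v
            ≈⟨ cong (a ∘ F₁ H h) (F-square H (μ A) (T₁ (μ A)) (μ A) (μ SA) (Monad.assoc monad A) (at φ (T₀ SA) ⟨$⟩ v)) ⟨
          a ⟨$⟩ F₁ H h ⟨$⟩ F₁ H (μ A) ⟨$⟩ F₁ H (T₁ (μ A)) ⟨$⟩ at φ (T₀ SA) ⟨$⟩ v
            ≈⟨ cong (a ∘ F₁ H h ∘ F₁ H (μ A)) (natural φ (μ A) v) ⟨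
          a ⟨$⟩ F₁ H h ⟨$⟩ F₁ H (μ A) ⟨$⟩ at φ SA ⟨$⟩ F₁ V (μ A) ⟨$⟩ v
            ≈⟨ h-τʳ (F₁ V (μ A) ⟨$⟩ v) ⟨
          h ⟨$⟩ τ A ⟨$⟩ inj₂ (F₁ V (μ A) ⟨$⟩ v)
            ≈⟨ cong h (μ-τ A (inj₂ v)) ⟨
          h ⟨$⟩ μ A ⟨$⟩ τ SA ⟨$⟩ inj₂ v ∎

        onη : (hₙ (suc n) ∘ T₁ h) ∘ η SA ⊑ (h ∘ μ A) ∘ η SA
        onη s = A.reflexive (A.Eq.trans (cong (hₙ (suc n)) (T₁-η h s))
          (A.Eq.trans (Φ-η (hₙ n) (h ⟨$⟩ s)) (A.Eq.sym (cong h (μ-η A s)))))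

    -- By `ev-least`; at a V-operation the arguments are evaluated before the expansion, and `h-T₁h`
    -- compares this with evaluating the flattened term.
    ev-⊑-h : ev e‡ ⊑ h
    ev-⊑-h = Ev.ev-least [ a , e‡ ] h onτ (λ x → A.reflexive (A.Eq.sym (h-η x)))
      where
      open PosetReasoning A.poset

      onτ : [ a , e‡ ] ∘ F₁ HV h ⊑ h ∘ τ A
      onτ (inj₁ x) = A.reflexive (A.Eq.sym (h-τˡ x))
      onτ (inj₂ v) = begin
        e‡ ⟨$⟩ F₁ V h ⟨$⟩ v
          ≈⟨ standardSolution-factor (F₁ V h ⟨$⟩ v) ⟩
        a ⟨$⟩ F₁ H h ⟨$⟩ at φ A ⟨$⟩ F₁ V h ⟨$⟩ v
          ≈⟨ cong (a ∘ F₁ H h) (natural φ h v) ⟩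
        a ⟨$⟩ F₁ H h ⟨$⟩ F₁ H (T₁ h) ⟨$⟩ at φ SA ⟨$⟩ v
          ≤⟨ mono a (F-square-⊑ H H-lc h (T₁ h) h (μ A) h-T₁h (at φ SA ⟨$⟩ v)) ⟩
        a ⟨$⟩ F₁ H h ⟨$⟩ F₁ H (μ A) ⟨$⟩ at φ SA ⟨$⟩ v
          ≈⟨ h-τʳ v ⟨
        h ⟨$⟩ τ A ⟨$⟩ inj₂ v ∎

    standardSolution-prefixed : R e e‡ ⊑ e‡
    standardSolution-prefixed v = begin
      R e e‡ ⟨$⟩ v                         ≈⟨ R-factor e‡ v ⟩
      a ⟨$⟩ F₁ H (ev e‡) ⟨$⟩ at φ A ⟨$⟩ v  ≤⟨ mono a (F₁-mono H H-lc (ev e‡) h ev-⊑-h (at φ A ⟨$⟩ v)) ⟩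
      a ⟨$⟩ F₁ H h ⟨$⟩ at φ A ⟨$⟩ v        ≈⟨ standardSolution-factor v ⟨
      e‡ ⟨$⟩ v                             ∎
      where open PosetReasoning A.poset

    standardSolution-isLeast : IsLeastFixedPoint Hom (R e) e‡
    standardSolution-isLeast = record
      { fixed = λ v → A.antisym (standardSolution-prefixed v)
          (standardSolution-⊑-R e‡ standardSolution-prefixed v)
      ; least = λ f Rf≈f v → A.trans
          (standardSolution-⊑-R f (λ w → A.reflexive (Rf≈f w)) v)
          (A.reflexive (Rf≈f v))
      }

theorem7p11 : ∀ {ℓ : Level} (H V : Functor ℓ)
    (H-lc : LocallyContinuous H) (V-lc : LocallyContinuous V) (HV-lc : LocallyContinuous (H +F V))
    (H-it : Iteratable H) (V-it : Iteratable V) (HV-it : Iteratable (H +F V))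
    (T-lc : LocallyContinuous (CompletelyIterativeMonad.T (H +F V) HV-it))
    (e : V ⟹ CompletelyIterativeMonad.T (H +F V) HV-it)
    (guarded : Scheme.Guarded H V HV-it e)
    (A : CPO ℓ) (a : F₀ H A ⇒ A)
    (⊥ : CPO.Carrier A) (⊥-min : Minimum (CPO._≤_ A) ⊥) →
    let module I = Interpretation H V HV-it H-lc HV-lc a ⊥ ⊥-min in
    IsContinuous [ F₀ V A ⇨ A ] [ F₀ V A ⇨ A ] (I.R e)
    × IsLeastFixedPoint [ F₀ V A ⇨ A ] (I.R e) (I.standardSolution e guarded)
theorem7p11 H V H-lc V-lc HV-lc H-it V-it HV-it T-lc e guarded A a ⊥ ⊥-min =
  R-continuous e , standardSolution-isLeast e guarded
  where open InterpretationProperties H V HV-it H-lc V-lc HV-lc a ⊥ ⊥-min
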